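{- Let $\{F(N)\}_{N\ge 0}$ be a family of series in $q$. For $a\ge 1$, \begin{align*} &\sum_{N_1,\ldots,N_{2a}\ge 0}\frac{q^{ \sum_{i=1}^ { 2a } \binom{N_i+1}{2}} F(N_{2a})}{(q;q)_{N_1}} \begin{bmatrix}N_1\\ N_2\end{bmatrix}\cdots \begin{bmatrix}N_{a-1}\\ N_{a}\end{bmatrix} \begin{bmatrix}N_a+1\\ N_{a+1}\end{bmatrix} \begin{bmatrix}N_{a+1}\\ N_{a+2}\end{bmatrix}\cdots \begin{bmatrix}N_{2a-1}\\ N_{2a}\end{bmatrix}\\ &= \sum_{N_1,\ldots,N_{2a}\ge 0}\frac{q^{ \sum_{i=1}^ { 2a} \binom{N_i+1}{2} -\sum_{i=1}^a N_{2i}} F(N_{2a})}{(q;q)_{N_1}}\begin{bmatrix}N_1\\ N_2\end{bmatrix}\begin{bmatrix}N_2\\ N_3\end{bmatrix}\cdots \begin{bmatrix}N_{2a-1}\\ N_{2a}\end{bmatrix}. \end{align*}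
   Context: $(q;q)_n=\prod_{j=1}^{n}(1-q^j)$; $\begin{bmatrix} N\\ M\end{bmatrix}=\frac{(q;q)_N}{(q;q)_M(q;q)_{N-M}}$ for $0\le M\le N$ and $0$ otherwise. Identities are between series in $q$ (the sums assumed well defined). -}

module Defs where

open import Level using (Level)
open import Data.Nat using (ℕ; zero; suc; _+_; _*_; _∸_; _≤_; _<_; _<?_; _≤ᵇ_; _≡ᵇ_; _%_)
open import Data.Nat.Combinatorics using (_C_)
open import Data.Fin using (Fin; fromℕ<)
open import Data.Bool using (if_then_else_)
open import Data.Product using (Σ; ∃; _×_)
open import Relation.Nullary using (yes; no)
open import Algebra.Bundles using (CommutativeRing)

-- 0-based access to a tuple (Fin n → ℕ); out of range gives 0 (never used out of range)
at : {n : ℕ} → (Fin n → ℕ) → ℕ → ℕ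
at {n} N i with i <? n
... | yes p = N (fromℕ< p)
... | no _  = 0

cons : {n : ℕ} → ℕ → (Fin n → ℕ) → Fin (suc n) → ℕ
cons x v Fin.zero    = x
cons x v (Fin.suc i) = v i

module Series {c ℓ : Level} (R : CommutativeRing c ℓ) where
  open CommutativeRing R renaming (_+_ to _+R_; _*_ to _*R_; _-_ to _-R_)

  PS : Set c
  PS = ℕ → Carrier

  sumR : ℕ → (ℕ → Carrier) → Carrier
  sumR zero    f = 0#
  sumR (suc n) f = sumR n f +R f n

  zeroS : PS
  zeroS _ = 0#

  addS : PS → PS → PS
  addS f g k = f k +R g k

  mulS : PS → PS → PS
  mulS f g k = sumR (suc k) (λ i → f i *R g (k ∸ i))

  qpow : ℕ → PS
  qpow m k = if k ≡ᵇ m then 1# else 0#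

  oneS : PS
  oneS = qpow 0

  poch : ℕ → PS
  poch zero    = oneS
  poch (suc n) = mulS (poch n) (λ k → oneS k -R qpow (suc n) k)

  -- 1/(1 - q^(m+1)) = Σ_t q^{(m+1) t}
  geo : ℕ → PS
  geo m k = if k % suc m ≡ᵇ 0 then 1# else 0#

  invPoch : ℕ → PS
  invPoch zero    = oneS
  invPoch (suc n) = mulS (invPoch n) (geo n)

  qbin : ℕ → ℕ → PS
  qbin N M = if M ≤ᵇ N then mulS (poch N) (mulS (invPoch M) (invPoch (N ∸ M))) else zeroS

  prodS : ℕ → (ℕ → PS) → PS
  prodS zero    f = oneS
  prodS (suc n) f = mulS (prodS n f) (f (suc n))

  boxSum : (n M : ℕ) → ((Fin n → ℕ) → PS) → PS
  boxSum zero    M t = t (λ ())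
  boxSum (suc n) M t k = sumR (suc M) (λ x → boxSum n M (λ v → t (cons x v)) k)

  HasSum : (n : ℕ) → ((Fin n → ℕ) → PS) → PS → Set ℓ
  HasSum n t s = ∀ k → ∃ λ M₀ → ∀ M → M₀ ≤ M → boxSum n M t k ≈ s k

  -- Σ_{i=1}^{2a} binom(N_i + 1, 2)   (N_i = at N (i-1))
  binSum : (a : ℕ) → (Fin (2 * a) → ℕ) → ℕ
  binSum a N = sumN (2 * a)
    where
      sumN : ℕ → ℕ
      sumN zero    = 0
      sumN (suc i) = sumN i + (suc (at N i)) C 2

  evenSum : (a : ℕ) → (Fin (2 * a) → ℕ) → ℕ
  evenSum a N = go a
    where
      go : ℕ → ℕ
      go zero    = 0
      go (suc i) = go i + at N (suc (2 * i))

  lhsTerm : (a : ℕ) → (ℕ → PS) → (Fin (2 * a) → ℕ) → PS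
  lhsTerm a F N =
    mulS (qpow (binSum a N))
      (mulS (F (at N (2 * a ∸ 1)))
        (mulS (invPoch (at N 0))
          (prodS (2 * a ∸ 1)
            (λ i → qbin (at N (i ∸ 1) + (if i ≡ᵇ a then 1 else 0)) (at N i)))))

  rhsTerm : (a : ℕ) → (ℕ → PS) → (Fin (2 * a) → ℕ) → PS
  rhsTerm a F N =
    mulS (qpow (binSum a N ∸ evenSum a N))
      (mulS (F (at N (2 * a ∸ 1)))
        (mulS (invPoch (at N 0))
          (prodS (2 * a ∸ 1) (λ i → qbin (at N (i ∸ 1)) (at N i)))))

{-# OPTIONS --safe #-}
module Submission where

-- Write N-indexed sums as row vectors: v = (1/(q)ₙ), and T the matrix q^{n(n+1)/2} [n, m]. With
-- X = diag(qⁿ), U the shift and Y = X + U, Pascal's rule identifies the left-hand side with the row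
-- v Tᵃ Y Tᵃ⁻¹, while the right-hand side is v T (X⁻¹ T T)ᵃ⁻¹ X⁻¹, so it suffices that
-- v Tᵃ Y Tᵃ⁺¹ = v Tᵃ⁺¹ Y Tᵃ X. The conjugates T⁻ⁱ Y Tⁱ form a quantum Q-system: a three-term
-- operator H commutes with T and satisfies Y H = q T⁻¹ Y T + T Y T⁻¹. For w i j = v Tⁱ Y Tʲ this gives
-- w i j H = w (i+1) (j−1) + q w (i−1) (j+1), hence a recurrence expressing each difference
-- E = w i (j+1) − w (i+1) j X through multiples by q of its neighbours. The boundary values are
-- antisymmetric under i ↔ j, so the symmetrised differences are divisible by every power of q and
-- vanish, and then so does the diagonal one.
-- All of this takes place modulo q^{k+1}, where q is nilpotent and all the sums are finite.

open import Defs
open import Level using (Level; _⊔_)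
open import Data.Nat using (ℕ; zero; suc; _≤_; _<_; _<?_; _∸_; _≤ᵇ_; _≡ᵇ_; _%_; z≤n; s≤s)
import Data.Nat as ℕ
import Data.Nat.Properties as ℕₚ
open import Data.Nat.Combinatorics using (_C_; nC1≡n; nCk+nC[k+1]≡[n+1]C[k+1])
open import Data.Nat.Tactic.RingSolver using (solve-∀)
open import Data.Nat.DivMod using (m<n⇒m%n≡m; [m+n]%n≡m%n)
open import Data.Bool using (true; false; if_then_else_)
open import Data.Empty using (⊥-elim)
open import Data.Fin using (Fin; fromℕ<)
open import Data.Maybe using (Maybe; just; nothing)
open import Data.Product using (Σ; _×_; _,_)
open import Data.Sum using (inj₁; inj₂)
open import Data.Unit using (tt)
open import Function using (_∘_)
open import Relation.Nullary using (yes; no)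
import Relation.Binary.PropositionalEquality as ≡
open ≡ using (_≡_; _≢_)
open import Algebra.Bundles using (CommutativeRing; RawRing)
open import Algebra.Solver.Ring.AlmostCommutativeRing using (fromCommutativeRing; _-Raw-AlmostCommutative⟶_)
import Algebra.Solver.Ring as RingSolver

-- Ring solver with integer coefficients over an arbitrary commutative ring.

module IntegerSolver {c ℓ : Level} (R : CommutativeRing c ℓ) where
  open CommutativeRing R
  open import Algebra.Properties.Semiring.Mult.TCOptimised semiring using (×-homo-+; ×1-homo-*) renaming (_×_ to _·_)
  open import Algebra.Properties.Ring ring using (-‿distribˡ-*; -‿distribʳ-*; -0#≈0#; -‿involutive)
  open import Algebra.Properties.AbelianGroup +-abelianGroup using () renaming (⁻¹-∙-comm to neg-+)
  open import Algebra.Properties.CommutativeSemigroup +-commutativeSemigroup using (interchange)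
  open import Relation.Binary.Reasoning.Setoid setoid

  -- The pair `(a , b)` stands for the integer a - b. Pairs are never normalised; `_≟′_` compares
  -- coefficients by cross sums instead.
  differences : RawRing _ _
  differences = record
    { Carrier = ℕ × ℕ
    ; _≈_     = ≡._≡_
    ; _+_     = λ { (a , b) (c , d) → a ℕ.+ c , b ℕ.+ d }
    ; _*_     = λ { (a , b) (c , d) → a ℕ.* c ℕ.+ b ℕ.* d , a ℕ.* d ℕ.+ b ℕ.* c }
    ; -_      = λ { (a , b) → b , a }
    ; 0#      = 0 , 0
    ; 1#      = 1 , 0
    }

  ι : ℕ → Carrier
  ι n = n · 1#

  -- The separate clause for second component zero makes 0 and 1 evaluate to `0#` and `1#`
  -- definitionally, so that `:1` reads as `1#` in solved equations.
  ⟦_⟧′ : ℕ × ℕ → Carrier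
  ⟦ a , zero  ⟧′ = ι a
  ⟦ a , suc b ⟧′ = ι a - ι (suc b)

  ⟦⟧′-difference : ∀ a b → ⟦ a , b ⟧′ ≈ ι a - ι b
  ⟦⟧′-difference a zero    = sym (trans (+-congˡ -0#≈0#) (+-identityʳ _))
  ⟦⟧′-difference a (suc b) = refl

  difference-+ : ∀ a b c d → (a + c) - (b + d) ≈ (a - b) + (c - d)
  difference-+ a b c d = begin
    (a + c) - (b + d)     ≈⟨ +-congˡ (sym (neg-+ b d)) ⟩
    (a + c) + (- b - d)   ≈⟨ interchange a c (- b) (- d) ⟩
    (a - b) + (c - d)     ∎

  difference-* : ∀ a b c d → (a * c + b * d) - (a * d + b * c) ≈ (a - b) * (c - d)
  difference-* a b c d = begin
    (a * c + b * d) - (a * d + b * c)       ≈⟨ +-congˡ (-‿cong (+-comm _ _)) ⟩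
    (a * c + b * d) - (b * c + a * d)       ≈⟨ difference-+ _ _ _ _ ⟩
    (a * c - b * c) + (b * d - a * d)       ≈⟨ +-cong (row c) (trans (neg-swap (b * d) (a * d)) (-‿cong (row d))) ⟩
    (a - b) * c - (a - b) * d               ≈⟨ +-congˡ (-‿distribʳ-* _ _) ⟩
    (a - b) * c + (a - b) * (- d)           ≈⟨ sym (distribˡ _ _ _) ⟩
    (a - b) * (c - d)                       ∎
    where
    row : ∀ x → a * x - b * x ≈ (a - b) * x
    row x = trans (+-congˡ (-‿distribˡ-* b x)) (sym (distribʳ _ _ _))
    neg-swap : ∀ x y → x - y ≈ - (y - x)
    neg-swap x y = sym (trans (sym (neg-+ _ _)) (trans (+-congˡ (-‿involutive x)) (+-comm _ _)))

  homomorphism : differences -Raw-AlmostCommutative⟶ fromCommutativeRing R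
  homomorphism = record
    { ⟦_⟧    = ⟦_⟧′
    ; +-homo = λ { (a , b) (c , d) → begin
        ⟦ a ℕ.+ c , b ℕ.+ d ⟧′             ≈⟨ ⟦⟧′-difference _ (b ℕ.+ d) ⟩
        ι (a ℕ.+ c) - ι (b ℕ.+ d)          ≈⟨ +-cong (×-homo-+ 1# a c) (-‿cong (×-homo-+ 1# b d)) ⟩
        (ι a + ι c) - (ι b + ι d)          ≈⟨ difference-+ _ _ _ _ ⟩
        (ι a - ι b) + (ι c - ι d)          ≈⟨ sym (+-cong (⟦⟧′-difference a b) (⟦⟧′-difference c d)) ⟩
        ⟦ a , b ⟧′ + ⟦ c , d ⟧′            ∎ }
    ; *-homo = λ { (a , b) (c , d) → begin
        ⟦ a ℕ.* c ℕ.+ b ℕ.* d , a ℕ.* d ℕ.+ b ℕ.* c ⟧′        ≈⟨ ⟦⟧′-difference _ (a ℕ.* d ℕ.+ b ℕ.* c) ⟩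
        ι (a ℕ.* c ℕ.+ b ℕ.* d) - ι (a ℕ.* d ℕ.+ b ℕ.* c)     ≈⟨ +-cong (ι-+* a c b d) (-‿cong (ι-+* a d b c)) ⟩
        (ι a * ι c + ι b * ι d) - (ι a * ι d + ι b * ι c)      ≈⟨ difference-* _ _ _ _ ⟩
        (ι a - ι b) * (ι c - ι d)          ≈⟨ sym (*-cong (⟦⟧′-difference a b) (⟦⟧′-difference c d)) ⟩
        ⟦ a , b ⟧′ * ⟦ c , d ⟧′            ∎ }
    ; -‿homo = λ { (a , b) → begin
        ⟦ b , a ⟧′        ≈⟨ ⟦⟧′-difference b a ⟩
        ι b - ι a         ≈⟨ +-comm _ _ ⟩
        - ι a + ι b       ≈⟨ +-congˡ (sym (-‿involutive _)) ⟩
        - ι a - - ι b     ≈⟨ neg-+ _ _ ⟩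
        - (ι a - ι b)     ≈⟨ -‿cong (sym (⟦⟧′-difference a b)) ⟩
        - ⟦ a , b ⟧′      ∎ }
    ; 0-homo = refl
    ; 1-homo = refl
    }
    where
    ι-+* : ∀ a c b d → ι (a ℕ.* c ℕ.+ b ℕ.* d) ≈ ι a * ι c + ι b * ι d
    ι-+* a c b d = trans (×-homo-+ 1# (a ℕ.* c) (b ℕ.* d)) (+-cong (×1-homo-* a c) (×1-homo-* b d))

  _≟′_ : ∀ x y → Maybe (⟦ x ⟧′ ≈ ⟦ y ⟧′)
  (a , b) ≟′ (c , d) with a ℕ.+ d ℕₚ.≟ c ℕ.+ b
  ... | no _  = nothing
  ... | yes e = just (begin
    ⟦ a , b ⟧′                    ≈⟨ ⟦⟧′-difference a b ⟩
    ι a - ι b                     ≈⟨ cancel (ι a) (ι b) (ι d) ⟩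
    (ι a + ι d) - (ι b + ι d)     ≈⟨ +-cong (sym (×-homo-+ 1# a d)) (-‿cong (+-comm _ _)) ⟩
    ι (a ℕ.+ d) - (ι d + ι b)     ≡⟨ ≡.cong (λ n → ι n - (ι d + ι b)) e ⟩
    ι (c ℕ.+ b) - (ι d + ι b)     ≈⟨ +-congʳ (×-homo-+ 1# c b) ⟩
    (ι c + ι b) - (ι d + ι b)     ≈⟨ sym (cancel (ι c) (ι d) (ι b)) ⟩
    ι c - ι d                     ≈⟨ sym (⟦⟧′-difference c d) ⟩
    ⟦ c , d ⟧′                    ∎)
    where
    cancel : ∀ x y z → x - y ≈ (x + z) - (y + z)
    cancel x y z = sym (trans (difference-+ x y z z) (trans (+-congˡ (-‿inverseʳ z)) (+-identityʳ _)))

  open RingSolver differences (fromCommutativeRing R) homomorphism _≟′_ public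

  :1 : ∀ {n} → Polynomial n
  :1 = con (1 , 0)

-- Finite sums.

module Sums {c ℓ : Level} (A : CommutativeRing c ℓ) where
  open CommutativeRing A
  open Series A using (sumR)
  open import Algebra.Properties.CommutativeSemigroup +-commutativeSemigroup using (interchange)
  open import Relation.Binary.Reasoning.Setoid setoid

  sum-cong : ∀ n {f g} → (∀ i → i < n → f i ≈ g i) → sumR n f ≈ sumR n g
  sum-cong zero    h = refl
  sum-cong (suc n) h = +-cong (sum-cong n (λ i i<n → h i (ℕₚ.m<n⇒m<1+n i<n))) (h n (ℕₚ.n<1+n n))

  sum-congˡ : ∀ n {f g} → (∀ i → f i ≈ g i) → sumR n f ≈ sumR n g
  sum-congˡ n h = sum-cong n (λ i _ → h i)

  sum-0 : ∀ n {f} → (∀ i → f i ≈ 0#) → sumR n f ≈ 0#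
  sum-0 zero    h = refl
  sum-0 (suc n) h = trans (+-cong (sum-0 n h) (h n)) (+-identityˡ 0#)

  sum-+ : ∀ n f g → sumR n (λ i → f i + g i) ≈ sumR n f + sumR n g
  sum-+ zero    f g = sym (+-identityˡ 0#)
  sum-+ (suc n) f g = trans (+-congʳ (sum-+ n f g)) (interchange _ _ _ _)

  sum-*ˡ : ∀ n x f → x * sumR n f ≈ sumR n (λ i → x * f i)
  sum-*ˡ zero    x f = zeroʳ x
  sum-*ˡ (suc n) x f = trans (distribˡ _ _ _) (+-congʳ (sum-*ˡ n x f))

  sum-*ʳ : ∀ n f x → sumR n f * x ≈ sumR n (λ i → f i * x)
  sum-*ʳ zero    f x = zeroˡ x
  sum-*ʳ (suc n) f x = trans (distribʳ _ _ _) (+-congʳ (sum-*ʳ n f x))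

  sum-swap : ∀ m n (f : ℕ → ℕ → Carrier) →
    sumR m (λ i → sumR n (f i)) ≈ sumR n (λ j → sumR m (λ i → f i j))
  sum-swap zero    n f = sym (sum-0 n (λ _ → refl))
  sum-swap (suc m) n f = trans (+-congʳ (sum-swap m n f)) (sym (sum-+ n _ _))

  sum-head : ∀ n f → sumR (suc n) f ≈ f 0 + sumR n (f ∘ suc)
  sum-head zero    f = +-comm _ _
  sum-head (suc n) f = trans (+-congʳ (sum-head n f)) (+-assoc _ _ _)

  -- Used for the index shifts in the operator identities below, where the terms at both ends
  -- vanish.
  sum-shift : ∀ n f → f 0 ≈ 0# → f n ≈ 0# → sumR n (f ∘ suc) ≈ sumR n f
  sum-shift n f f0 fn = begin
    sumR n (f ∘ suc)        ≈⟨ +-identityˡ _ ⟨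
    0# + sumR n (f ∘ suc)   ≈⟨ +-congʳ f0 ⟨
    f 0 + sumR n (f ∘ suc)  ≈⟨ sum-head n f ⟨
    sumR n f + f n          ≈⟨ +-congˡ fn ⟩
    sumR n f + 0#           ≈⟨ +-identityʳ _ ⟩
    sumR n f                ∎

  sum-extend : ∀ n k f → (∀ i → n ≤ i → f i ≈ 0#) → sumR (k ℕ.+ n) f ≈ sumR n f
  sum-extend n zero    f h = refl
  sum-extend n (suc k) f h = trans (+-cong (sum-extend n k f h) (h (k ℕ.+ n) (ℕₚ.m≤n+m n k))) (+-identityʳ _)

-- Powers of q and q-binomial coefficients.

-- pw n stands for qⁿ
record QPowers {c ℓ : Level} (A : CommutativeRing c ℓ) : Set (c ⊔ ℓ) where
  open CommutativeRing A
  field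
    pw geo      : ℕ → Carrier
    pw-0        : pw 0 ≈ 1#
    pw-suc      : ∀ n → pw (suc n) ≈ pw 1 * pw n
    geo-inverse : ∀ m → (1# - pw (suc m)) * geo m ≈ 1#

module QBinomials {c ℓ : Level} (A : CommutativeRing c ℓ) (P : QPowers A) where
  open CommutativeRing A
  open QPowers P
  open IntegerSolver A using (solve; _:=_; _:+_; _:*_; _:-_; :1)
  open import Relation.Binary.Reasoning.Setoid setoid

  q : Carrier
  q = pw 1

  pw-+ : ∀ m n → pw (m ℕ.+ n) ≈ pw m * pw n
  pw-+ zero    n = sym (trans (*-congʳ pw-0) (*-identityˡ _))
  pw-+ (suc m) n = begin
    pw (suc (m ℕ.+ n))      ≈⟨ pw-suc (m ℕ.+ n) ⟩
    q * pw (m ℕ.+ n)        ≈⟨ *-congˡ (pw-+ m n) ⟩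
    q * (pw m * pw n)       ≈⟨ *-assoc _ _ _ ⟨
    q * pw m * pw n         ≈⟨ *-congʳ (pw-suc m) ⟨
    pw (suc m) * pw n       ∎

  poch : ℕ → Carrier
  poch zero    = 1#
  poch (suc n) = poch n * (1# - pw (suc n))

  invPoch : ℕ → Carrier
  invPoch zero    = 1#
  invPoch (suc n) = invPoch n * geo n

  bin : ℕ → ℕ → Carrier
  bin n m = if m ≤ᵇ n then poch n * (invPoch m * invPoch (n ∸ m)) else 0#

  invPoch-pred : ∀ m → invPoch m ≈ (1# - q * pw m) * invPoch (suc m)
  invPoch-pred m = begin
    invPoch m                                       ≈⟨ *-identityʳ _ ⟨
    invPoch m * 1#                                  ≈⟨ *-congˡ (geo-inverse m) ⟨
    invPoch m * ((1# - pw (suc m)) * geo m)         ≈⟨ *-congˡ (*-congʳ (+-congˡ (-‿cong (pw-suc m)))) ⟩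
    invPoch m * ((1# - q * pw m) * geo m)           ≈⟨ solve 3 (λ v x g → v :* (x :* g) := x :* (v :* g)) refl _ _ _ ⟩
    (1# - q * pw m) * (invPoch m * geo m)           ∎

  poch-suc : ∀ n → poch (suc n) ≈ poch n * (1# - q * pw n)
  poch-suc n = *-congˡ (+-congˡ (-‿cong (pw-suc n)))

  bin-≤ : ∀ m d {n} → m ℕ.+ d ≡ n → bin n m ≈ poch n * (invPoch m * invPoch d)
  bin-≤ m d ≡.refl with m ≤ᵇ m ℕ.+ d | ℕₚ.≤⇒≤ᵇ (ℕₚ.m≤m+n m d)
  ... | true | _ = reflexive (≡.cong (λ k → poch (m ℕ.+ d) * (invPoch m * invPoch k)) (ℕₚ.m+n∸m≡n m d))

  bin-> : ∀ {m n} → n < m → bin n m ≈ 0#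
  bin-> {m} {n} n<m with m ≤ᵇ n | ℕₚ.≤ᵇ⇒≤ m n
  ... | false | _ = refl
  ... | true  | h = ⊥-elim (ℕₚ.<⇒≱ n<m (h tt))

  -- Carrying the complement `d` in place of `n ∸ m` lets `bin-≤` and `invPoch-pred` be applied
  -- without truncated subtraction.
  data Order : ℕ → ℕ → Set where
    above : ∀ {m n} → n < m → Order m n
    below : ∀ {m n} d → m ℕ.+ d ≡ n → Order m n

  order : ∀ m n → Order m n
  order m n with ℕₚ.≤-<-connex m n
  ... | inj₁ m≤n = below (n ∸ m) (ℕₚ.m+[n∸m]≡n m≤n)
  ... | inj₂ n<m = above n<m

  shift : (ℕ → Carrier) → ℕ → Carrier
  shift r zero    = 0#
  shift r (suc m) = r m

  bin-absorb : ∀ n m → (1# - q * pw m) * bin (suc n) (suc m) ≈ (1# - q * pw n) * bin n m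
  bin-absorb n m with order m n
  ... | above n<m = trans (trans (*-congˡ (bin-> (s≤s n<m))) (zeroʳ _)) (sym (trans (*-congˡ (bin-> n<m)) (zeroʳ _)))
  ... | below d e = begin
    (1# - q * pw m) * bin (suc n) (suc m)
      ≈⟨ *-congˡ (trans (bin-≤ (suc m) d (≡.cong suc e)) (*-congʳ (poch-suc n))) ⟩
    (1# - q * pw m) * (poch n * (1# - q * pw n) * (invPoch (suc m) * invPoch d))
      ≈⟨ solve 5 (λ a p b v w → a :* (p :* b :* (v :* w)) := b :* (p :* (a :* v :* w))) refl _ _ _ _ _ ⟩
    (1# - q * pw n) * (poch n * ((1# - q * pw m) * invPoch (suc m) * invPoch d))
      ≈⟨ *-congˡ (*-congˡ (*-congʳ (invPoch-pred m))) ⟨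
    (1# - q * pw n) * (poch n * (invPoch m * invPoch d))
      ≈⟨ *-congˡ (bin-≤ m d e) ⟨
    (1# - q * pw n) * bin n m ∎

  -- (1 − q^{n+1−m}) [n+1, m] = (1 − q^{n+1}) [n, m], times qᵐ to avoid the negative exponent
  bin-top : ∀ n m → (pw m - q * pw n) * bin (suc n) m ≈ pw m * ((1# - q * pw n) * bin n m)
  bin-top n m with order m n
  ... | above n<m = trans (vanish n<m) (sym (trans (*-congˡ (trans (*-congˡ (bin-> n<m)) (zeroʳ _))) (zeroʳ _)))
    where
    vanish : n < m → (pw m - q * pw n) * bin (suc n) m ≈ 0#
    vanish n<m with ℕₚ.m≤n⇒m<n∨m≡n n<m
    ... | inj₁ lt = trans (*-congˡ (bin-> lt)) (zeroʳ _)
    -- At m = n + 1 the binomial is 1; it is the factor `pw m - q * pw n` that vanishes.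
    ... | inj₂ ≡.refl = trans (*-congʳ (trans (+-congʳ (pw-suc n)) (-‿inverseʳ _))) (zeroˡ _)
  ... | below d e = begin
    (pw m - q * pw n) * bin (suc n) m
      ≈⟨ *-cong (+-congˡ (-‿cong (*-congˡ (trans (reflexive (≡.cong pw (≡.sym e))) (pw-+ m d)))))
                (trans (bin-≤ m (suc d) (≡.trans (ℕₚ.+-suc m d) (≡.cong suc e))) (*-congʳ (poch-suc n))) ⟩
    (pw m - q * (pw m * pw d)) * (poch n * (1# - q * pw n) * (invPoch m * invPoch (suc d)))
      ≈⟨ solve 7 (λ y q z p b v w → (y :- q :* (y :* z)) :* (p :* b :* (v :* w)) := y :* (b :* (p :* (v :* ((:1 :- q :* z) :* w))))) refl _ _ _ _ _ _ _ ⟩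
    pw m * ((1# - q * pw n) * (poch n * (invPoch m * ((1# - q * pw d) * invPoch (suc d)))))
      ≈⟨ *-congˡ (*-congˡ (*-congˡ (*-congˡ (invPoch-pred d)))) ⟨
    pw m * ((1# - q * pw n) * (poch n * (invPoch m * invPoch d)))
      ≈⟨ *-congˡ (*-congˡ (bin-≤ m d e)) ⟨
    pw m * ((1# - q * pw n) * bin n m) ∎

  -- The source of Y = X + U: raising the upper index amounts to multiplication by qᵐ plus a shift
  -- of the output index.
  bin-pascal : ∀ n m → bin (suc n) m ≈ pw m * bin n m + shift (bin n) m
  bin-pascal n zero = begin
    bin (suc n) 0
      ≈⟨ trans (bin-≤ 0 (suc n) ≡.refl) (*-congʳ (poch-suc n)) ⟩
    poch n * (1# - q * pw n) * (1# * invPoch (suc n))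
      ≈⟨ solve 3 (λ p a v → p :* a :* (:1 :* v) := :1 :* (p :* (:1 :* (a :* v)))) refl _ _ _ ⟩
    1# * (poch n * (1# * ((1# - q * pw n) * invPoch (suc n))))
      ≈⟨ *-cong (sym pw-0) (*-congˡ (*-congˡ (sym (invPoch-pred n)))) ⟩
    pw 0 * (poch n * (1# * invPoch n))
      ≈⟨ *-congˡ (bin-≤ 0 n ≡.refl) ⟨
    pw 0 * bin n 0
      ≈⟨ +-identityʳ _ ⟨
    pw 0 * bin n 0 + 0# ∎
  bin-pascal n (suc m) with order m n
  ... | above n<m = begin
    bin (suc n) (suc m)                     ≈⟨ bin-> (s≤s n<m) ⟩
    0#                                      ≈⟨ +-identityˡ 0# ⟨
    0# + 0#                                 ≈⟨ +-cong (trans (*-congˡ (bin-> (ℕₚ.m<n⇒m<1+n n<m))) (zeroʳ _)) (bin-> n<m) ⟨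
    pw (suc m) * bin n (suc m) + bin n m    ∎
  ... | below zero e = begin
    bin (suc n) (suc m)
      ≈⟨ trans (bin-≤ (suc m) 0 (≡.cong suc e)) (*-congʳ (poch-suc n)) ⟩
    poch n * (1# - q * pw n) * (invPoch (suc m) * 1#)
      ≈⟨ *-congʳ (*-congˡ (+-congˡ (-‿cong (*-congˡ (reflexive (≡.cong pw (≡.trans (≡.sym e) (ℕₚ.+-identityʳ m)))))))) ⟩
    poch n * (1# - q * pw m) * (invPoch (suc m) * 1#)
      ≈⟨ solve 3 (λ p a v → p :* a :* (v :* :1) := p :* (a :* v :* :1)) refl _ _ _ ⟩
    poch n * ((1# - q * pw m) * invPoch (suc m) * 1#)
      ≈⟨ *-congˡ (*-congʳ (invPoch-pred m)) ⟨
    poch n * (invPoch m * 1#)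
      ≈⟨ bin-≤ m 0 e ⟨
    bin n m
      ≈⟨ +-identityˡ _ ⟨
    0# + bin n m
      ≈⟨ +-congʳ (trans (*-congˡ (bin-> (s≤s (ℕₚ.≤-reflexive (≡.trans (≡.sym e) (ℕₚ.+-identityʳ m)))))) (zeroʳ _)) ⟨
    pw (suc m) * bin n (suc m) + bin n m ∎
  ... | below (suc d) e = begin
    bin (suc n) (suc m)
      ≈⟨ trans (bin-≤ (suc m) (suc d) (≡.cong suc e)) (*-congʳ (poch-suc n)) ⟩
    poch n * (1# - q * pw n) * (invPoch (suc m) * invPoch (suc d))
      ≈⟨ *-congʳ (*-congˡ (+-congˡ (-‿cong (*-congˡ
           (trans (reflexive (≡.cong pw (≡.trans (≡.sym e) (ℕₚ.+-suc m d))))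
           (trans (pw-suc (m ℕ.+ d)) (*-congˡ (pw-+ m d)))))))) ⟩
    poch n * (1# - q * (q * (pw m * pw d))) * (invPoch (suc m) * invPoch (suc d))
      -- With y = qᵐ and z = q^d this is 1 - q^(m+d+2) = q^(m+1) (1 - q^(d+1)) + (1 - q^(m+1)).
      ≈⟨ solve 6 (λ p q y z v w →
           p :* (:1 :- q :* (q :* (y :* z))) :* (v :* w) :=
           q :* y :* (p :* (v :* ((:1 :- q :* z) :* w))) :+ p :* ((:1 :- q :* y) :* v :* w)) refl _ _ _ _ _ _ ⟩
    q * pw m * (poch n * (invPoch (suc m) * ((1# - q * pw d) * invPoch (suc d))))
      + poch n * ((1# - q * pw m) * invPoch (suc m) * invPoch (suc d))
      ≈⟨ +-cong (*-cong (pw-suc m) (*-congˡ (*-congˡ (invPoch-pred d)))) (*-congˡ (*-congʳ (invPoch-pred m))) ⟨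
    pw (suc m) * (poch n * (invPoch (suc m) * invPoch d)) + poch n * (invPoch m * invPoch (suc d))
      ≈⟨ +-cong (*-congˡ (bin-≤ (suc m) d (≡.trans (≡.sym (ℕₚ.+-suc m d)) e))) (bin-≤ m (suc d) e) ⟨
    pw (suc m) * bin n (suc m) + bin n m ∎

  -- (1 − q^{m+1}) [n, m+1] = (1 − q^{n−m}) [n, m], times qᵐ
  bin-right : ∀ n m → pw m * ((1# - q * pw m) * bin n (suc m)) ≈ (pw m - pw n) * bin n m
  bin-right n m with order m n
  ... | above n<m =
    trans (trans (*-congˡ (trans (*-congˡ (bin-> (ℕₚ.m<n⇒m<1+n n<m))) (zeroʳ _))) (zeroʳ _))
          (sym (trans (*-congˡ (bin-> n<m)) (zeroʳ _)))
  ... | below zero e =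
    trans (trans (*-congˡ (trans (*-congˡ (bin-> (s≤s (ℕₚ.≤-reflexive (≡.sym m≡n))))) (zeroʳ _))) (zeroʳ _))
          (sym (trans (*-congʳ (trans (+-congʳ (reflexive (≡.cong pw m≡n))) (-‿inverseʳ _))) (zeroˡ _)))
    where
    m≡n : m ≡ n
    m≡n = ≡.trans (≡.sym (ℕₚ.+-identityʳ m)) e
  ... | below (suc d) e = begin
    pw m * ((1# - q * pw m) * bin n (suc m))
      ≈⟨ *-congˡ (*-congˡ (trans (bin-≤ (suc m) d (≡.trans (≡.sym (ℕₚ.+-suc m d)) e)) (*-congˡ (*-congˡ (invPoch-pred d))))) ⟩
    pw m * ((1# - q * pw m) * (poch n * (invPoch (suc m) * ((1# - q * pw d) * invPoch (suc d)))))
      ≈⟨ solve 6 (λ y q p v z w →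
           y :* ((:1 :- q :* y) :* (p :* (v :* ((:1 :- q :* z) :* w)))) :=
           (y :- q :* (y :* z)) :* (p :* ((:1 :- q :* y) :* v :* w))) refl _ _ _ _ _ _ ⟩
    (pw m - q * (pw m * pw d)) * (poch n * ((1# - q * pw m) * invPoch (suc m) * invPoch (suc d)))
      ≈⟨ *-cong (+-congˡ (-‿cong (trans (reflexive (≡.cong pw (≡.trans (≡.sym e) (ℕₚ.+-suc m d))))
                                        (trans (pw-suc (m ℕ.+ d)) (*-congˡ (pw-+ m d))))))
                (trans (bin-≤ m (suc d) e) (*-congˡ (*-congʳ (invPoch-pred m)))) ⟨
    (pw m - pw n) * bin n m ∎

  -- Shares its right side with `bin-right`, so that together they trade lower index m + 1 for upper
  -- index n - 1. For n > 0 it is `bin-top` read one step lower.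
  bin-left : ∀ n m → pw m * ((1# - pw n) * shift (λ k → bin k m) n) ≈ (pw m - pw n) * bin n m
  bin-left zero zero = trans (trans (*-congˡ (zeroʳ _)) (zeroʳ _)) (sym (trans (*-congʳ (-‿inverseʳ _)) (zeroˡ _)))
  bin-left zero (suc m) = trans (trans (*-congˡ (zeroʳ _)) (zeroʳ _)) (sym (zeroʳ _))
  bin-left (suc n) m = begin
    pw m * ((1# - pw (suc n)) * bin n m)     ≈⟨ *-congˡ (*-congʳ (+-congˡ (-‿cong (pw-suc n)))) ⟩
    pw m * ((1# - q * pw n) * bin n m)       ≈⟨ bin-top n m ⟨
    (pw m - q * pw n) * bin (suc n) m        ≈⟨ *-congʳ (+-congˡ (-‿cong (pw-suc n))) ⟨
    (pw m - pw (suc n)) * bin (suc n) m      ∎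

-- Exponents built from triangular numbers.

sumℕ : ℕ → (ℕ → ℕ) → ℕ
sumℕ zero    f = 0
sumℕ (suc n) f = sumℕ n f ℕ.+ f n

-- Gives access to the local summation functions of `binSum` and `evenSum` through their recursion
-- alone.
sumℕ-unique : ∀ {f s : ℕ → ℕ} → s 0 ≡ 0 → (∀ i → s (suc i) ≡ s i ℕ.+ f i) → ∀ n → s n ≡ sumℕ n f
sumℕ-unique         s0 s+ zero    = s0
sumℕ-unique {f = f} s0 s+ (suc n) = ≡.trans (s+ n) (≡.cong (ℕ._+ f n) (sumℕ-unique s0 s+ n))

-- Subtracting x lowers binom(x + 1, 2) to binom(x, 2). Indices are 0-based here, so the lowered
-- entries are the odd ones.
alternatingExponent : ℕ → ℕ → ℕ
alternatingExponent zero          x = suc x C 2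
alternatingExponent (suc zero)    x = x C 2
alternatingExponent (suc (suc i)) x = alternatingExponent i x

alternatingExponent-even : ∀ j x → alternatingExponent (j ℕ.+ j) x ≡ suc x C 2
alternatingExponent-even zero    x = ≡.refl
alternatingExponent-even (suc j) x rewrite ℕₚ.+-suc j j = alternatingExponent-even j x

alternatingExponent-odd : ∀ j x → alternatingExponent (suc (j ℕ.+ j)) x ≡ x C 2
alternatingExponent-odd zero    x = ≡.refl
alternatingExponent-odd (suc j) x rewrite ℕₚ.+-suc j j = alternatingExponent-odd j x

[1+n]C2 : ∀ n → suc n C 2 ≡ n C 2 ℕ.+ n
[1+n]C2 n = ≡.trans (≡.sym (nCk+nC[k+1]≡[n+1]C[k+1] n 1))
  (≡.trans (≡.cong (ℕ._+ n C 2) (nC1≡n n)) (ℕₚ.+-comm n (n C 2)))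

-- The part to be subtracted stands in front as a summand, so truncated subtraction cancels it
-- exactly.
sumℕ-alternating : ∀ (f : ℕ → ℕ) j → sumℕ (j ℕ.+ j) (λ i → suc (f i) C 2) ≡
  sumℕ j (λ i → f (suc (2 ℕ.* i))) ℕ.+ sumℕ (j ℕ.+ j) (λ i → alternatingExponent i (f i))
sumℕ-alternating f zero = ≡.refl
sumℕ-alternating f (suc j) rewrite ℕₚ.+-suc j j | ℕₚ.+-identityʳ j | alternatingExponent-even j (f (j ℕ.+ j))
  | alternatingExponent-odd j (f (suc (j ℕ.+ j))) | [1+n]C2 (f (suc (j ℕ.+ j))) | sumℕ-alternating f j =
  rearrange (sumℕ j (λ i → f (suc (2 ℕ.* i)))) (sumℕ (j ℕ.+ j) (λ i → alternatingExponent i (f i)))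
    (suc (f (j ℕ.+ j)) C 2) (f (suc (j ℕ.+ j)) C 2) (f (suc (j ℕ.+ j)))
  where
  rearrange : ∀ a b x y z → a ℕ.+ b ℕ.+ x ℕ.+ (y ℕ.+ z) ≡ a ℕ.+ z ℕ.+ (b ℕ.+ x ℕ.+ y)
  rearrange = solve-∀

at-cons-suc : ∀ {n} x (v : Fin n → ℕ) i → at (cons x v) (suc i) ≡ at v i
at-cons-suc {n} x v i with suc i <? suc n | i <? n
... | yes (s≤s p) | yes p′ = ≡.cong (λ p → v (fromℕ< p)) (ℕₚ.≤-irrelevant p p′)
... | yes (s≤s p) | no i≮n = ⊥-elim (i≮n p)
... | no i≮n      | yes p′ = ⊥-elim (i≮n (s≤s p′))
... | no _        | no _   = ≡.refl

-- Nested sums as a row multiplied by a product of kernels.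

module Chains {c ℓ : Level} (A : CommutativeRing c ℓ) where
  open CommutativeRing A
  open IntegerSolver A using (solve; _:=_; _:*_)
  open Series A using (sumR)
  open Sums A
  open import Algebra.Properties.CommutativeSemigroup *-commutativeSemigroup using (interchange)
  open import Relation.Binary.Reasoning.Setoid setoid

  Row Kernel : Set c
  Row    = ℕ → Carrier
  Kernel = ℕ → ℕ → Carrier

  infix 4 _≋_
  _≋_ : Row → Row → Set ℓ
  r ≋ s = ∀ m → r m ≈ s m

  act : ℕ → Row → Kernel → Row
  act M r L m = sumR (suc M) (λ n → r n * L n m)

  act-cong : ∀ M {r s L L′} → r ≋ s → (∀ n m → L n m ≈ L′ n m) → act M r L ≋ act M s L′
  act-cong M h l m = sum-congˡ (suc M) (λ n → *-cong (h n) (l n m))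

  product : ℕ → (ℕ → Carrier) → Carrier
  product zero    f = 1#
  product (suc n) f = product n f * f (suc n)

  product-cong : ∀ n {f g} → (∀ i → f (suc i) ≈ g (suc i)) → product n f ≈ product n g
  product-cong zero    h = refl
  product-cong (suc n) h = *-cong (product-cong n h) (h n)

  product-head : ∀ n f → product (suc n) f ≈ f 1 * product n (f ∘ suc)
  product-head zero    f = *-comm _ _
  product-head (suc n) f = trans (*-congʳ (product-head n f)) (*-assoc _ _ _)

  product-* : ∀ n f g → product n (λ i → f i * g i) ≈ product n f * product n g
  product-* zero    f g = sym (*-identityˡ 1#)
  product-* (suc n) f g = trans (*-congʳ (product-* n f g)) (interchange _ _ _ _)

  box : (n M : ℕ) → ((Fin n → ℕ) → Carrier) → Carrier
  box zero    M t = t (λ ())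
  box (suc n) M t = sumR (suc M) (λ x → box n M (λ v → t (cons x v)))

  box-cong : ∀ n M {t t′} → (∀ N → t N ≈ t′ N) → box n M t ≈ box n M t′
  box-cong zero    M h = h _
  box-cong (suc n) M h = sum-congˡ (suc M) (λ x → box-cong n M (λ v → h (cons x v)))

  -- The summand of a transfer-matrix product: initial row `r`, transitions `L 1` to `L n`, end
  -- column `g`.
  chain : ∀ n → Row → (ℕ → Kernel) → Row → (Fin (suc n) → ℕ) → Carrier
  chain n r L g N = r (at N 0) * product n (λ i → L i (at N (i ∸ 1)) (at N i)) * g (at N n)

  chain-cons : ∀ n r L g x v → chain (suc n) r L g (cons x v) ≈ chain n (λ y → r x * L 1 x y) (L ∘ suc) g v
  chain-cons n r L g x v = *-cong (begin
    r (at N 0) * product (suc n) (λ i → L i (at N (i ∸ 1)) (at N i))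
      ≈⟨ *-congˡ (product-head n _) ⟩
    r (at N 0) * (L 1 (at N 0) (at N 1) * product n (λ i → L (suc i) (at N i) (at N (suc i))))
      ≈⟨ *-assoc _ _ _ ⟨
    r (at N 0) * L 1 (at N 0) (at N 1) * product n (λ i → L (suc i) (at N i) (at N (suc i)))
      ≈⟨ *-cong (reflexive (≡.cong (λ y → r x * L 1 x y) (at-cons-suc x v 0)))
                (product-cong n (λ i → reflexive (≡.cong₂ (L (suc (suc i))) (at-cons-suc x v i) (at-cons-suc x v (suc i))))) ⟩
    r x * L 1 x (at v 0) * product n (λ i → L (suc i) (at v (i ∸ 1)) (at v i)) ∎)
    (reflexive (≡.cong g (at-cons-suc x v n)))
    where
    N : Fin (suc (suc n)) → ℕ
    N = cons x v

  row : ℕ → ℕ → Row → (ℕ → Kernel) → Row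
  row M zero    r L = r
  row M (suc n) r L = act M (row M n r L) (L (suc n))

  total : ℕ → ℕ → Row → (ℕ → Kernel) → Row → Carrier
  total M n r L g = sumR (suc M) (λ x → row M n r L x * g x)

  -- `box` peels off the first variable whereas `row` appends kernels at the end; this reconciles
  -- the two orders.
  row-cons : ∀ M n r L → row M n (act M r (L 1)) (L ∘ suc) ≋ row M (suc n) r L
  row-cons M zero    r L m = refl
  row-cons M (suc n) r L   = act-cong M {L = L (suc (suc n))} (row-cons M n r L) (λ _ _ → refl)

  row-sum : ∀ M n p (r : ℕ → Row) L → row M n (λ y → sumR p (λ x → r x y)) L ≋ λ y → sumR p (λ x → row M n (r x) L y)
  row-sum M zero    p r L m = refl
  row-sum M (suc n) p r L m = begin
    act M (row M n (λ y → sumR p (λ x → r x y)) L) (L (suc n)) m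
      ≈⟨ act-cong M {L = L (suc n)} (row-sum M n p r L) (λ _ _ → refl) m ⟩
    sumR (suc M) (λ y → sumR p (λ x → row M n (r x) L y) * L (suc n) y m)
      ≈⟨ sum-congˡ (suc M) (λ y → sum-*ʳ p _ _) ⟩
    sumR (suc M) (λ y → sumR p (λ x → row M n (r x) L y * L (suc n) y m))
      ≈⟨ sum-swap (suc M) p _ ⟩
    sumR p (λ x → row M (suc n) (r x) L m) ∎

  -- Induction from the left: a fixed first value x is absorbed into the initial row, and linearity
  -- in that row (`row-sum`) lets the sum over x be carried out first.
  box-chain : ∀ M n r L g → box (suc n) M (chain n r L g) ≈ total M n r L g
  box-chain M zero r L g = sum-congˡ (suc M) (λ x → *-congʳ (*-identityʳ _))
  box-chain M (suc n) r L g = begin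
    sumR (suc M) (λ x → box (suc n) M (λ v → chain (suc n) r L g (cons x v)))
      ≈⟨ sum-congˡ (suc M) (λ x → trans (box-cong (suc n) M (chain-cons n r L g x)) (box-chain M n _ _ g)) ⟩
    sumR (suc M) (λ x → sumR (suc M) (λ y → row M n (λ y → r x * L 1 x y) (L ∘ suc) y * g y))
      ≈⟨ sum-swap (suc M) (suc M) _ ⟩
    sumR (suc M) (λ y → sumR (suc M) (λ x → row M n (λ y → r x * L 1 x y) (L ∘ suc) y * g y))
      ≈⟨ sum-congˡ (suc M) (λ y → sum-*ʳ (suc M) _ (g y)) ⟨
    sumR (suc M) (λ y → sumR (suc M) (λ x → row M n (λ y → r x * L 1 x y) (L ∘ suc) y) * g y)
      ≈⟨ sum-congˡ (suc M) (λ y → *-congʳ (trans (sym (row-sum M n (suc M) _ (L ∘ suc) y)) (row-cons M n r L y))) ⟩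
    total M (suc n) r L g ∎

  -- Each weight moves into the transition that leaves its variable; the last variable is left by
  -- none, so its weight joins the end column.
  weighted-chain : ∀ n (r : Row) (weight : ℕ → Row) (L : ℕ → Kernel) (g : Row) N →
    product (suc n) (λ i → weight (i ∸ 1) (at N (i ∸ 1))) *
      (g (at N n) * (r (at N 0) * product n (λ i → L i (at N (i ∸ 1)) (at N i)))) ≈
    chain n r (λ i x y → weight (i ∸ 1) x * L i x y) (λ x → weight n x * g x) N
  weighted-chain n r weight L g N = begin
    W * weight n z * (g z * (r x * P))
      ≈⟨ solve 5 (λ W v g r P → W :* v :* (g :* (r :* P)) := r :* (W :* P) :* (v :* g)) refl _ _ _ _ _ ⟩
    r x * (W * P) * (weight n z * g z)
      ≈⟨ *-congʳ (*-congˡ (product-* n _ _)) ⟨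
    chain n r (λ i x y → weight (i ∸ 1) x * L i x y) (λ x → weight n x * g x) N ∎
    where
    x z : ℕ
    x = at N 0
    z = at N n
    W P : Carrier
    W = product n (λ i → weight (i ∸ 1) (at N (i ∸ 1)))
    P = product n (λ i → L i (at N (i ∸ 1)) (at N i))

  sum-stable : ∀ N k (r g : Row) → (∀ x → N ≤ x → g x ≈ 0#) →
    sumR (suc (k ℕ.+ N)) (λ x → r x * g x) ≈ sumR (suc N) (λ x → r x * g x)
  sum-stable N k r g h = begin
    sumR (suc (k ℕ.+ N)) (λ x → r x * g x)
      ≡⟨ ≡.cong (λ p → sumR p (λ x → r x * g x)) (≡.sym (ℕₚ.+-suc k N)) ⟩
    sumR (k ℕ.+ suc N) (λ x → r x * g x)
      ≈⟨ sum-extend (suc N) k _ (λ x N<x → trans (*-congˡ (h x (ℕₚ.<⇒≤ N<x))) (zeroʳ _)) ⟩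
    sumR (suc N) (λ x → r x * g x) ∎

  row-stable : ∀ N k n r L → (∀ i x y → N ≤ x → L i x y ≈ 0#) → row (k ℕ.+ N) n r L ≋ row N n r L
  row-stable N k zero    r L h m = refl
  row-stable N k (suc n) r L h m = trans
    (act-cong (k ℕ.+ N) {L = L (suc n)} (row-stable N k n r L h) (λ _ _ → refl) m)
    (sum-stable N k (row N n r L) (λ x → L (suc n) x m) (λ x → h (suc n) x m))

  -- Makes the box sums eventually constant, which is what `HasSum` asks for.
  total-stable : ∀ N k n r L g → (∀ i x y → N ≤ x → L i x y ≈ 0#) → (∀ x → N ≤ x → g x ≈ 0#) →
    total (k ℕ.+ N) n r L g ≈ total N n r L g
  total-stable N k n r L g hL hg = trans
    (sum-congˡ (suc (k ℕ.+ N)) (λ x → *-congʳ (row-stable N k n r L hL x)))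
    (sum-stable N k (row N n r L) g hg)

-- Operators on rows over a ring in which q is nilpotent.

module Rows {c ℓ : Level} (A : CommutativeRing c ℓ) (P : QPowers A)
  (N : ℕ) (pw-nilpotent : CommutativeRing._≈_ A (QPowers.pw P N) (CommutativeRing.0# A)) where
  open CommutativeRing A
  open QPowers P
  open IntegerSolver A using (solve; _:=_; _:+_; _:*_; _:-_; :-_; :1)
  open import Relation.Binary.Reasoning.Setoid setoid
  open Series A using (sumR)
  open Sums A
  open Chains A
  open QBinomials A P

  -- triangle⁻ n = q^{n(n-1)/2} and triangle n = q^{n(n+1)/2}
  triangle⁻ : ℕ → Carrier
  triangle⁻ zero    = 1#
  triangle⁻ (suc n) = triangle⁻ n * pw n

  triangle : ℕ → Carrier
  triangle n = triangle⁻ n * pw n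

  triangle-vanishes : ∀ {n} → N ≤ n → triangle n ≈ 0#
  triangle-vanishes {n} N≤n = begin
    triangle⁻ n * pw n                  ≡⟨ ≡.cong (λ k → triangle⁻ n * pw k) (≡.sym (ℕₚ.m+[n∸m]≡n N≤n)) ⟩
    triangle⁻ n * pw (N ℕ.+ (n ∸ N))    ≈⟨ *-congˡ (trans (pw-+ N (n ∸ N)) (trans (*-congʳ pw-nilpotent) (zeroˡ _))) ⟩
    triangle⁻ n * 0#                    ≈⟨ zeroʳ _ ⟩
    0#                                  ∎

  -- The kernels of T, of X⁻¹ T and, by Pascal's rule, of T followed by Y. Using `triangle⁻` avoids
  -- inverting the nilpotent q.
  τ τ⁻ τ⁺ : Kernel
  τ  n m = triangle n * bin n m
  τ⁻ n m = triangle⁻ n * bin n m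
  τ⁺ n m = triangle n * bin (suc n) m

  -- K is H X for the conserved operator H = X⁻¹ + q X − U⁻¹ (1 − q² X²), which would need negative powers of q.
  X Y K U : Row → Row
  X r m = pw m * r m
  U = shift
  Y r m = pw m * r m + U r m
  K r m = (1# + q * pw m * pw m) * r m - pw m * ((1# - (q * pw m) * (q * pw m)) * r (suc m))

  K-cong : ∀ {r s} → r ≋ s → K r ≋ K s
  K-cong h m = +-cong (*-congˡ (h m)) (-‿cong (*-congˡ (*-congˡ (h (suc m)))))

  -- Supplies the boundary values w 0 j = v Tʲ.
  Y-invPoch : Y invPoch ≋ invPoch
  Y-invPoch zero = trans (+-identityʳ _) (trans (*-congʳ pw-0) (*-identityˡ _))
  Y-invPoch (suc m) = begin
    pw (suc m) * invPoch (suc m) + invPoch m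
      ≈⟨ +-cong (*-congʳ (pw-suc m)) (invPoch-pred m) ⟩
    q * pw m * invPoch (suc m) + (1# - q * pw m) * invPoch (suc m)
      ≈⟨ solve 2 (λ x v → x :* v :+ (:1 :- x) :* v := v) refl _ _ ⟩
    invPoch (suc m) ∎

  -- With y = qᵐ, the factor 1 - (q y)² splits as (1 - q y) (1 + q y), and 1 - q y lowers
  -- `invPoch (suc m)`. This is v H X = v U, the start of the induction for `K-w`.
  K-invPoch : K invPoch ≋ U invPoch
  K-invPoch m = begin
    (1# + q * pw m * pw m) * invPoch m - pw m * ((1# - (q * pw m) * (q * pw m)) * invPoch (suc m))
      ≈⟨ solve 4 (λ q y v w →
           (:1 :+ q :* y :* y) :* v :- y :* ((:1 :- (q :* y) :* (q :* y)) :* w) :=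
           (:1 :+ q :* y :* y) :* v :- y :* ((:1 :+ q :* y) :* ((:1 :- q :* y) :* w))) refl _ _ _ _ ⟩
    (1# + q * pw m * pw m) * invPoch m - pw m * ((1# + q * pw m) * ((1# - q * pw m) * invPoch (suc m)))
      ≈⟨ +-congˡ (-‿cong (*-congˡ (*-congˡ (invPoch-pred m)))) ⟨
    (1# + q * pw m * pw m) * invPoch m - pw m * ((1# + q * pw m) * invPoch m)
      ≈⟨ solve 3 (λ q y v → (:1 :+ q :* y :* y) :* v :- y :* ((:1 :+ q :* y) :* v) := (:1 :- y) :* v) refl _ _ _ ⟩
    (1# - pw m) * invPoch m
      ≈⟨ lower m ⟩
    U invPoch m ∎
    where
    lower : ∀ m → (1# - pw m) * invPoch m ≈ U invPoch m
    lower zero    = trans (*-congʳ (trans (+-congˡ (-‿cong pw-0)) (-‿inverseʳ 1#))) (zeroˡ _)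
    lower (suc m) = trans (*-congʳ (+-congˡ (-‿cong (pw-suc m)))) (sym (invPoch-pred m))

  lhsKernel : ℕ → ℕ → Kernel
  lhsKernel a i x y = triangle x * bin (x ℕ.+ (if i ≡ᵇ a then 1 else 0)) y

  alternatingWeight : ℕ → Row
  alternatingWeight zero          = triangle
  alternatingWeight (suc zero)    = triangle⁻
  alternatingWeight (suc (suc i)) = alternatingWeight i

  alternatingWeight-even : ∀ j x → alternatingWeight (j ℕ.+ j) x ≡ triangle x
  alternatingWeight-even zero    x = ≡.refl
  alternatingWeight-even (suc j) x rewrite ℕₚ.+-suc j j = alternatingWeight-even j x

  alternatingWeight-odd : ∀ j x → alternatingWeight (suc (j ℕ.+ j)) x ≡ triangle⁻ x
  alternatingWeight-odd zero    x = ≡.refl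
  alternatingWeight-odd (suc j) x rewrite ℕₚ.+-suc j j = alternatingWeight-odd j x

  rhsKernel : ℕ → Kernel
  rhsKernel i x y = alternatingWeight (i ∸ 1) x * bin x y

  -- Relations between T, Y and the conserved operator H.

  module Truncated (M : ℕ) (N≤M : N ≤ M) where

    T T⁻ : Row → Row
    T  r = act M r τ
    T⁻ r = act M r τ⁻

    T-cong : ∀ {r s} → r ≋ s → T r ≋ T s
    T-cong h = act-cong M h (λ _ _ → refl)

    T⁻-cong : ∀ {r s} → r ≋ s → T⁻ r ≋ T⁻ s
    T⁻-cong h = act-cong M h (λ _ _ → refl)

    T⁻-X : ∀ r → T⁻ (X r) ≋ T r
    T⁻-X r m = sum-congˡ (suc M) (λ n →
      solve 4 (λ x r t b → x :* r :* (t :* b) := r :* (t :* x :* b)) refl (pw n) (r n) (triangle⁻ n) (bin n m))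

    -- Shifting n by one turns `triangle⁻ (suc n)` into `triangle n`. With `Y-T` this gives T Y = U
    -- X⁻¹ T, the form of T Y T⁻¹ = U X⁻¹ without T⁻¹.
    T⁻-U : ∀ r → T⁻ (U r) ≋ act M r τ⁺
    T⁻-U r m = sym (sum-shift (suc M) (λ n → U r n * τ⁻ n m) (zeroˡ _)
      (trans (*-congˡ (trans (*-congʳ (triangle-vanishes N≤M)) (zeroˡ _))) (zeroʳ _)))

    U-T : ∀ r m → U (T r) m ≈ sumR (suc M) (λ n → r n * (triangle n * U (bin n) m))
    U-T r zero    = sym (sum-0 (suc M) (λ n → trans (*-congˡ (zeroʳ _)) (zeroʳ _)))
    U-T r (suc m) = refl

    Y-T : ∀ r → Y (T r) ≋ act M r τ⁺
    Y-T r m = begin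
      pw m * T r m + U (T r) m
        ≈⟨ +-cong (sum-*ˡ (suc M) _ _) (U-T r m) ⟩
      sumR (suc M) (λ n → pw m * (r n * τ n m)) + sumR (suc M) (λ n → r n * (triangle n * U (bin n) m))
        ≈⟨ sum-+ (suc M) _ _ ⟨
      sumR (suc M) (λ n → pw m * (r n * τ n m) + r n * (triangle n * U (bin n) m))
        ≈⟨ sum-congˡ (suc M) (λ n → trans
             (solve 5 (λ y r t b u → y :* (r :* (t :* b)) :+ r :* (t :* u) := r :* (t :* (y :* b :+ u))) refl _ _ _ _ _)
             (*-congˡ (*-congˡ (sym (bin-pascal n m))))) ⟩
      sumR (suc M) (λ n → r n * τ⁺ n m) ∎

    K-act : ∀ r L m → K (act M r L) m ≈
      sumR (suc M) (λ n → r n * ((1# + q * pw m * pw m) * L n m - pw m * ((1# - (q * pw m) * (q * pw m)) * L n (suc m))))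
    K-act r L m = begin
      α * act M r L m - β * (γ * act M r L (suc m))
        ≈⟨ solve 5 (λ a b c x z → a :* x :- b :* (c :* z) := a :* x :+ ((:1 :- :1 :- b :* c) :* z)) refl _ _ _ _ _ ⟩
      α * act M r L m + δ * act M r L (suc m)
        ≈⟨ +-cong (sum-*ˡ (suc M) _ _) (sum-*ˡ (suc M) _ _) ⟩
      sumR (suc M) (λ n → α * (r n * L n m)) + sumR (suc M) (λ n → δ * (r n * L n (suc m)))
        ≈⟨ sum-+ (suc M) _ _ ⟨
      sumR (suc M) (λ n → α * (r n * L n m) + δ * (r n * L n (suc m)))
        ≈⟨ sum-congˡ (suc M) (λ n →
             solve 6 (λ a b c r x z → a :* (r :* x) :+ (:1 :- :1 :- b :* c) :* (r :* z) := r :* (a :* x :- b :* (c :* z))) refl _ _ _ _ _ _) ⟩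
      sumR (suc M) (λ n → r n * (α * L n m - β * (γ * L n (suc m)))) ∎
      where
      α β γ δ : Carrier
      α = 1# + q * pw m * pw m
      β = pw m
      γ = 1# - (q * pw m) * (q * pw m)
      δ = 1# - 1# - β * γ

    -- H commutes with T: as K = H X and `T⁻` = X⁻¹ T, this is T H X = H T X. The lower index m + 1
    -- produced by K is traded for the upper index n - 1, and a shift of the summation index then
    -- moves the change onto `r`.
    K-T : ∀ r → K (T r) ≋ X (T⁻ (K r))
    K-T r m = begin
      K (T r) m
        ≈⟨ K-act r τ m ⟩
      sumR (suc M) (λ n → r n * ((1# + q * y * y) * τ n m - y * ((1# - (q * y) * (q * y)) * τ n (suc m))))
        ≈⟨ sum-congˡ (suc M) (λ n → trans (*-congˡ (kernel n)) (split n)) ⟩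
      sumR (suc M) (λ n → f n + h n)
        ≈⟨ sum-+ (suc M) _ _ ⟩
      sumR (suc M) f + sumR (suc M) h
        ≈⟨ +-congˡ (sum-shift (suc M) h h-first h-last) ⟨
      sumR (suc M) f + sumR (suc M) (h ∘ suc)
        ≈⟨ sum-+ (suc M) _ _ ⟨
      sumR (suc M) (λ n → f n + h (suc n))
        ≈⟨ sum-congˡ (suc M) regroup ⟩
      sumR (suc M) (λ n → y * (K r n * τ⁻ n m))
        ≈⟨ sum-*ˡ (suc M) _ _ ⟨
      y * T⁻ (K r) m ∎
      where
      y : Carrier
      y = pw m
      pred : ℕ → Carrier
      pred = shift (λ k → bin k m)
      f h : ℕ → Carrier
      f n = y * ((1# + q * pw n * pw n) * r n * (triangle⁻ n * bin n m))
      h n = (1# - 1# - y) * ((1# - pw n * pw n) * r n * (triangle⁻ n * pred n))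

      kernel : ∀ n → (1# + q * y * y) * τ n m - y * ((1# - (q * y) * (q * y)) * τ n (suc m)) ≈
        triangle⁻ n * (y * ((1# + q * pw n * pw n) * bin n m)) - triangle⁻ n * (y * ((1# - pw n * pw n) * pred n))
      kernel n = begin
        (1# + q * y * y) * (t * x * b) - y * ((1# - (q * y) * (q * y)) * (t * x * bin n (suc m)))
          ≈⟨ solve 6 (λ q y t x b b′ →
               (:1 :+ q :* y :* y) :* (t :* x :* b) :- y :* ((:1 :- (q :* y) :* (q :* y)) :* (t :* x :* b′)) :=
               t :* x :* ((:1 :+ q :* y :* y) :* b) :- t :* x :* (:1 :+ q :* y) :* (y :* ((:1 :- q :* y) :* b′))) refl _ _ _ _ _ _ ⟩
        t * x * ((1# + q * y * y) * b) - t * x * (1# + q * y) * (y * ((1# - q * y) * bin n (suc m)))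
          ≈⟨ +-congˡ (-‿cong (*-congˡ (bin-right n m))) ⟩
        t * x * ((1# + q * y * y) * b) - t * x * (1# + q * y) * ((y - x) * b)
          ≈⟨ solve 5 (λ q y t x b →
               t :* x :* ((:1 :+ q :* y :* y) :* b) :- t :* x :* (:1 :+ q :* y) :* ((y :- x) :* b) :=
               t :* (y :* ((:1 :+ q :* x :* x) :* b)) :- t :* ((:1 :+ x) :* ((y :- x) :* b))) refl _ _ _ _ _ ⟩
        t * (y * ((1# + q * x * x) * b)) - t * ((1# + x) * ((y - x) * b))
          ≈⟨ +-congˡ (-‿cong (*-congˡ (*-congˡ (bin-left n m)))) ⟨
        t * (y * ((1# + q * x * x) * b)) - t * ((1# + x) * (y * ((1# - x) * pred n)))
          ≈⟨ +-congˡ (-‿cong (solve 4 (λ t x y p →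
               t :* ((:1 :+ x) :* (y :* ((:1 :- x) :* p))) := t :* (y :* ((:1 :- x :* x) :* p))) refl _ _ _ _)) ⟩
        t * (y * ((1# + q * x * x) * b)) - t * (y * ((1# - x * x) * pred n)) ∎
        where
        x t b : Carrier
        x = pw n
        t = triangle⁻ n
        b = bin n m

      split : ∀ n → r n * (triangle⁻ n * (y * ((1# + q * pw n * pw n) * bin n m)) - triangle⁻ n * (y * ((1# - pw n * pw n) * pred n))) ≈ f n + h n
      split n = solve 7 (λ r t y q x b p →
        r :* (t :* (y :* ((:1 :+ q :* x :* x) :* b)) :- t :* (y :* ((:1 :- x :* x) :* p))) :=
        y :* ((:1 :+ q :* x :* x) :* r :* (t :* b)) :+ (:1 :- :1 :- y) :* ((:1 :- x :* x) :* r :* (t :* p))) refl _ _ _ _ _ _ _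

      h-first : h 0 ≈ 0#
      h-first = trans (*-congˡ (trans (*-congˡ (zeroʳ _)) (zeroʳ _))) (zeroʳ _)

      h-last : h (suc M) ≈ 0#
      h-last = trans (*-congˡ (trans (*-congˡ (trans (*-congʳ (triangle-vanishes N≤M)) (zeroˡ _))) (zeroʳ _))) (zeroʳ _)

      regroup : ∀ n → f n + h (suc n) ≈ y * (K r n * τ⁻ n m)
      regroup n = begin
        f n + (1# - 1# - y) * ((1# - pw (suc n) * pw (suc n)) * r (suc n) * (triangle⁻ n * pw n * bin n m))
          ≈⟨ +-congˡ (*-congˡ (*-congʳ (*-congʳ (+-congˡ (-‿cong (*-cong (pw-suc n) (pw-suc n))))))) ⟩
        f n + (1# - 1# - y) * ((1# - (q * pw n) * (q * pw n)) * r (suc n) * (triangle⁻ n * pw n * bin n m))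
          ≈⟨ solve 7 (λ y q x r s t b →
               y :* ((:1 :+ q :* x :* x) :* r :* (t :* b)) :+ (:1 :- :1 :- y) :* ((:1 :- (q :* x) :* (q :* x)) :* s :* (t :* x :* b)) :=
               y :* (((:1 :+ q :* x :* x) :* r :- x :* ((:1 :- (q :* x) :* (q :* x)) :* s)) :* (t :* b))) refl y q (pw n) (r n) (r (suc n)) (triangle⁻ n) (bin n m) ⟩
        y * (K r n * τ⁻ n m) ∎

    -- The relation Y H = q T⁻¹ Y T + T Y T⁻¹, multiplied by T on the left and X on the right; U
    -- stands for T Y T⁻¹ X.
    K-Y-T : ∀ r m → K (Y (T r)) m ≈ U (T r) m + q * X (T (Y r)) m
    K-Y-T r m = begin
      K (Y (T r)) m
        ≈⟨ K-cong (Y-T r) m ⟩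
      K (act M r τ⁺) m
        ≈⟨ K-act r τ⁺ m ⟩
      sumR (suc M) (λ n → r n * ((1# + q * y * y) * τ⁺ n m - y * ((1# - (q * y) * (q * y)) * τ⁺ n (suc m))))
        ≈⟨ sum-congˡ (suc M) kernel ⟩
      sumR (suc M) (λ n → f n + (g n + h (suc n)))
        ≈⟨ trans (sum-+ (suc M) _ _) (+-congˡ (sum-+ (suc M) _ _)) ⟩
      sumR (suc M) f + (sumR (suc M) g + sumR (suc M) (h ∘ suc))
        ≈⟨ +-congˡ (+-congˡ (sum-shift (suc M) h h-first h-last)) ⟩
      sumR (suc M) f + (sumR (suc M) g + sumR (suc M) h)
        ≈⟨ +-congˡ (sum-+ (suc M) _ _) ⟨
      sumR (suc M) f + sumR (suc M) (λ n → g n + h n)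
        ≈⟨ +-congˡ (sum-congˡ (suc M) (λ n →
             solve 7 (λ q y x r u t b → q :* y :* (x :* r :* (t :* b)) :+ q :* y :* (u :* (t :* b)) := q :* y :* ((x :* r :+ u) :* (t :* b)))
               refl q y (pw n) (r n) (U r n) (triangle n) (bin n m))) ⟩
      sumR (suc M) f + sumR (suc M) (λ n → q * y * (Y r n * τ n m))
        ≈⟨ +-cong (U-T r m) (trans (sym (*-assoc _ _ _)) (sum-*ˡ (suc M) _ _)) ⟨
      U (T r) m + q * (y * T (Y r) m) ∎
      where
      y : Carrier
      y = pw m
      f g h : ℕ → Carrier
      f n = r n * (triangle n * U (bin n) m)
      g n = q * y * (pw n * r n * τ n m)
      h n = q * y * (U r n * τ n m)

      kernel : ∀ n → r n * ((1# + q * y * y) * τ⁺ n m - y * ((1# - (q * y) * (q * y)) * τ⁺ n (suc m))) ≈ f n + (g n + h (suc n))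
      kernel n = begin
        ρ * ((1# + q * y * y) * (t * s) - y * ((1# - (q * y) * (q * y)) * (t * bin (suc n) (suc m))))
          -- Splits 1 + q y² as 1 + q y (y - q x) + q y (q x): Pascal's rule applies to the first
          -- piece, `bin-top` to the second, and the third is left for the shifted sum `h`.
          ≈⟨ solve 7 (λ ρ q y t s s′ x →
               ρ :* ((:1 :+ q :* y :* y) :* (t :* s) :- y :* ((:1 :- (q :* y) :* (q :* y)) :* (t :* s′))) :=
               ρ :* t :* (s :+ q :* y :* ((y :- q :* x) :* s) :+ q :* y :* (q :* x) :* s :- y :* (:1 :+ q :* y) :* ((:1 :- q :* y) :* s′)))
               refl ρ q y t s (bin (suc n) (suc m)) x ⟩
        ρ * t * (s + q * y * ((y - q * x) * s) + q * y * (q * x) * s - y * (1# + q * y) * ((1# - q * y) * bin (suc n) (suc m)))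
          ≈⟨ *-congˡ (+-cong (+-congʳ (+-cong (bin-pascal n m) (*-congˡ (bin-top n m)))) (-‿cong (*-congˡ (bin-absorb n m)))) ⟩
        ρ * t * (y * b + U (bin n) m + q * y * (y * ((1# - q * x) * b)) + q * y * (q * x) * s - y * (1# + q * y) * ((1# - q * x) * b))
          ≈⟨ solve 8 (λ ρ q y t s x b u →
               ρ :* t :* (y :* b :+ u :+ q :* y :* (y :* ((:1 :- q :* x) :* b)) :+ q :* y :* (q :* x) :* s :- y :* (:1 :+ q :* y) :* ((:1 :- q :* x) :* b)) :=
               ρ :* (t :* u) :+ (q :* y :* (x :* ρ :* (t :* b)) :+ q :* y :* (ρ :* (t :* (q :* x) :* s))))
               refl ρ q y t s x b (U (bin n) m) ⟩
        f n + (g n + q * y * (ρ * (t * (q * x) * s)))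
          ≈⟨ +-congˡ (+-congˡ (*-congˡ (*-congˡ (*-congʳ (*-congˡ (pw-suc n)))))) ⟨
        f n + (g n + h (suc n)) ∎
        where
        x t b s ρ : Carrier
        x = pw n
        t = triangle n
        b = bin n m
        s = bin (suc n) m
        ρ = r n

      h-first : h 0 ≈ 0#
      h-first = trans (*-congˡ (zeroˡ _)) (zeroʳ _)

      h-last : h (suc M) ≈ 0#
      h-last = trans (*-congˡ (trans (*-congˡ (trans (*-congʳ (triangle-vanishes (ℕₚ.m≤n⇒m≤1+n N≤M))) (zeroˡ _))) (zeroʳ _))) (zeroʳ _)

    -- The rows `w i j`, their three-term relation and their differences.

    iterT : ℕ → Row → Row
    iterT zero    r = r
    iterT (suc j) r = T (iterT j r)

    iterT-cong : ∀ j {r s} → r ≋ s → iterT j r ≋ iterT j s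
    iterT-cong zero    h = h
    iterT-cong (suc j) h = T-cong (iterT-cong j h)

    power : ℕ → Row
    power i = iterT i invPoch

    w : ℕ → ℕ → Row
    w i j = iterT j (Y (power i))

    w-zero : ∀ j → w 0 j ≋ power j
    w-zero j = iterT-cong j Y-invPoch

    -- next i j and prev i j play the roles of X (w (i + 1) (j - 1)) and w (i - 1) (j + 1), also for j = 0 and i = 0.
    next prev : ℕ → ℕ → Row
    next i zero    = U (power i)
    next i (suc j) = X (w (suc i) j)
    prev zero    j = λ _ → 0#
    prev (suc i) j = w i (suc j)

    T⁻-next : ∀ i j → T⁻ (next i j) ≋ w (suc i) j
    T⁻-next i zero    m = trans (T⁻-U (power i) m) (sym (Y-T (power i) m))
    T⁻-next i (suc j) = T⁻-X (w (suc i) j)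

    T-prev : ∀ i j → T (prev i j) ≋ prev i (suc j)
    T-prev zero    j m = sum-0 (suc M) (λ _ → zeroˡ _)
    T-prev (suc i) j m = refl

    -- This is w i j H = w (i + 1) (j - 1) + q w (i - 1) (j + 1), times X. Induction on j, as H
    -- commutes past the last T; the base case is `K-Y-T`, or `K-invPoch` when i = 0.
    K-w : ∀ i j m → K (w i j) m ≈ next i j m + q * X (prev i j) m
    K-w zero zero m = begin
      K (Y invPoch) m               ≈⟨ K-cong Y-invPoch m ⟩
      K invPoch m                   ≈⟨ K-invPoch m ⟩
      U invPoch m                   ≈⟨ +-identityʳ _ ⟨
      U invPoch m + 0#              ≈⟨ +-congˡ (trans (*-congˡ (zeroʳ _)) (zeroʳ _)) ⟨
      U invPoch m + q * (pw m * 0#) ∎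
    K-w (suc i) zero m = K-Y-T (power i) m
    K-w i (suc j) m = begin
      K (T (w i j)) m
        ≈⟨ K-T (w i j) m ⟩
      pw m * T⁻ (K (w i j)) m
        ≈⟨ *-congˡ (T⁻-cong (K-w i j) m) ⟩
      pw m * T⁻ (λ n → next i j n + q * X (prev i j) n) m
        ≈⟨ *-congˡ (trans (sum-congˡ (suc M) (λ n →
             solve 4 (λ a q b l → (a :+ q :* b) :* l := a :* l :+ q :* (b :* l)) refl (next i j n) q (X (prev i j) n) (τ⁻ n m)))
             (trans (sum-+ (suc M) _ _) (+-congˡ (sym (sum-*ˡ (suc M) q _))))) ⟩
      pw m * (T⁻ (next i j) m + q * T⁻ (X (prev i j)) m)
        ≈⟨ *-congˡ (+-cong (T⁻-next i j m) (*-congˡ (trans (T⁻-X (prev i j) m) (T-prev i j m)))) ⟩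
      pw m * (w (suc i) j m + q * prev i (suc j) m)
        ≈⟨ solve 4 (λ y a q b → y :* (a :+ q :* b) := y :* a :+ q :* (y :* b)) refl _ _ _ _ ⟩
      pw m * w (suc i) j m + q * (pw m * prev i (suc j) m) ∎

    -- Formally w (i - 1) j - w i (j - 1) X, with the out-of-range terms as in `prev` and `next`;
    -- both indices are thus one higher than i and j in w i (j + 1) - w (i + 1) j X. The value 0 at
    -- `E 0 0` keeps the boundary antisymmetric.
    E : ℕ → ℕ → Row
    E zero    zero    m = 0#
    E zero    (suc j) m = 0# - X (w 0 j) m
    E (suc i) j       m = w i j m - next i j m

    E-prev : ∀ i j m → E i (suc j) m ≈ prev i j m - X (w i j) m
    E-prev zero    j m = refl
    E-prev (suc i) j m = refl

    -- On the right, `h` comes with a factor q and the neighbouring entry of `g` with a factor qᵐ;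
    -- this drives the divisibility argument.
    Recurrence : Row → Row → Set ℓ
    Recurrence g h = ∀ m → (1# + (q * pw m) * (q * pw m)) * g m ≈
      q * (pw m * h m) + pw m * ((1# - (q * pw m) * (q * pw m)) * g (suc m))

    E-recurrence : ∀ i j → Recurrence (E (suc i) (suc j)) (λ m → E i (suc (suc j)) m + E (suc (suc i)) j m)
    E-recurrence i j m = begin
      (1# + Q) * (a - y * b)
        -- Subtracting q y times the three-term relation of `b` from that of `a` leaves `a⁺` and
        -- `b⁺` only in the combination `a⁺ - q * y * b⁺`, which is the same difference at `suc m`.
        ≈⟨ solve 8 (λ q y a a⁺ b b⁺ p n →
             (:1 :+ (q :* y) :* (q :* y)) :* (a :- y :* b) :=
             ((:1 :+ q :* y :* y) :* a :- y :* ((:1 :- (q :* y) :* (q :* y)) :* a⁺)) :- y :* b :- q :* y :* (y :* a) :+ q :* y :* b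
               :- q :* y :* (((:1 :+ q :* y :* y) :* b :- y :* ((:1 :- (q :* y) :* (q :* y)) :* b⁺)) :- q :* (y :* a))
               :+ y :* ((:1 :- (q :* y) :* (q :* y)) :* (a⁺ :- q :* y :* b⁺)))
             refl q y a a⁺ b b⁺ p n ⟩
      K (w i (suc j)) m - y * b - q * y * (y * a) + q * y * b - q * y * (K (w (suc i) j) m - q * (y * a))
        + y * ((1# - Q) * (a⁺ - q * y * b⁺))
        ≈⟨ +-congʳ (+-cong (+-congʳ (+-congʳ (+-congʳ (K-w i (suc j) m)))) (-‿cong (*-congˡ (+-congʳ (K-w (suc i) j m))))) ⟩
      (y * b + q * (y * p)) - y * b - q * y * (y * a) + q * y * b - q * y * ((n + q * (y * a)) - q * (y * a))
        + y * ((1# - Q) * (a⁺ - q * y * b⁺))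
        ≈⟨ solve 7 (λ q y a b p n z →
             (y :* b :+ q :* (y :* p)) :- y :* b :- q :* y :* (y :* a) :+ q :* y :* b :- q :* y :* ((n :+ q :* (y :* a)) :- q :* (y :* a)) :+ z :=
             q :* (y :* ((p :- y :* a) :+ (b :- n))) :+ z) refl q y a b p n _ ⟩
      q * (y * ((p - y * a) + (b - n))) + y * ((1# - Q) * (a⁺ - q * y * b⁺))
        ≈⟨ +-cong (*-congˡ (*-congˡ (+-congʳ (sym (E-prev i (suc j) m)))))
                  (*-congˡ (*-congˡ (+-congˡ (-‿cong (*-congʳ (sym (pw-suc m))))))) ⟩
      q * (y * (E i (suc (suc j)) m + E (suc (suc i)) j m)) + y * ((1# - Q) * E (suc i) (suc j) (suc m)) ∎
      where
      y Q a a⁺ b b⁺ p n : Carrier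
      y  = pw m
      Q  = (q * y) * (q * y)
      a  = w i (suc j) m
      a⁺ = w i (suc j) (suc m)
      b  = w (suc i) j m
      b⁺ = w (suc i) j (suc m)
      p  = prev i (suc j) m
      n  = next (suc i) j m

    -- Vanishing through divisibility by powers of q.

    q^_∣_ : ℕ → Carrier → Set (c ⊔ ℓ)
    q^ s ∣ z = Σ Carrier (λ u → z ≈ pw s * u)

    ∣-0 : ∀ s {z} → z ≈ 0# → q^ s ∣ z
    ∣-0 s z≈0 = 0# , trans z≈0 (sym (zeroʳ _))

    ∣-+ : ∀ {s x y} → q^ s ∣ x → q^ s ∣ y → q^ s ∣ (x + y)
    ∣-+ (u , x≈) (v , y≈) = u + v , trans (+-cong x≈ y≈) (sym (distribˡ _ _ _))

    ∣-nilpotent : ∀ {z} → q^ N ∣ z → z ≈ 0#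
    ∣-nilpotent (u , z≈) = trans z≈ (trans (*-congʳ pw-nilpotent) (zeroˡ u))

    -- Each pass gains one power of q. The term (q y)² g is moved to the other side, where it has
    -- q-powers to spare, so nothing is divided by 1 + (q y)².
    recurrence-∣ : ∀ {g h} → Recurrence g h → ∀ s → (∀ m → q^ s ∣ g m) → (∀ m → q^ s ∣ h m) → ∀ m → q^ suc s ∣ g m
    recurrence-∣ {g} {h} rec s s∣g s∣h = go
      where
      step : ∀ m → q^ suc s ∣ (pw m * g (suc m)) → q^ suc s ∣ g m
      step m (u , e) with s∣g m | s∣h m
      ... | v , ev | z , ez = y * z + u - q * y * y * (q * u + v) , (begin
        g m
          ≈⟨ solve 3 (λ q y g → g := (:1 :+ (q :* y) :* (q :* y)) :* g :- (q :* y) :* (q :* y) :* g) refl q y (g m) ⟩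
        (1# + (q * y) * (q * y)) * g m - (q * y) * (q * y) * g m
          ≈⟨ +-congʳ (rec m) ⟩
        q * (y * h m) + y * ((1# - (q * y) * (q * y)) * g (suc m)) - (q * y) * (q * y) * g m
          ≈⟨ solve 5 (λ q y h g⁺ g →
               q :* (y :* h) :+ y :* ((:1 :- (q :* y) :* (q :* y)) :* g⁺) :- (q :* y) :* (q :* y) :* g :=
               q :* (y :* h) :+ (:1 :- (q :* y) :* (q :* y)) :* (y :* g⁺) :- (q :* y) :* (q :* y) :* g)
               refl q y (h m) (g (suc m)) (g m) ⟩
        q * (y * h m) + (1# - (q * y) * (q * y)) * (y * g (suc m)) - (q * y) * (q * y) * g m
          ≈⟨ +-cong (+-cong (*-congˡ (*-congˡ ez)) (*-congˡ (trans e (*-congʳ (pw-suc s))))) (-‿cong (*-congˡ ev)) ⟩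
        q * (y * (pw s * z)) + (1# - (q * y) * (q * y)) * (q * pw s * u) - (q * y) * (q * y) * (pw s * v)
          ≈⟨ solve 6 (λ q y p z u v →
               q :* (y :* (p :* z)) :+ (:1 :- (q :* y) :* (q :* y)) :* (q :* p :* u) :- (q :* y) :* (q :* y) :* (p :* v) :=
               q :* p :* (y :* z :+ u :- q :* y :* y :* (q :* u :+ v))) refl q y (pw s) z u v ⟩
        q * pw s * (y * z + u - q * y * y * (q * u + v))
          ≈⟨ *-congʳ (pw-suc s) ⟨
        pw (suc s) * (y * z + u - q * y * y * (q * u + v)) ∎)
        where
        y : Carrier
        y = pw m

      -- For m > 0 the factor qᵐ already contributes a power of q; m = 0 then reduces to m = 1.
      go : ∀ m → q^ suc s ∣ g m
      go zero with go 1
      ... | u , e = step 0 (pw 0 * u , trans (*-congˡ e)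
        (solve 3 (λ y p u → y :* (p :* u) := p :* (y :* u)) refl _ _ _))
      go (suc m) with s∣g (suc (suc m))
      ... | u , e = step (suc m) (pw m * u , trans (*-cong (pw-suc m) e) (trans
        (solve 4 (λ q y p u → q :* y :* (p :* u) := q :* p :* (y :* u)) refl _ _ _ _)
        (*-congʳ (sym (pw-suc s)))))

    G : ℕ → ℕ → Row
    G i j m = E i j m + E j i m

    G-recurrence : ∀ i j → Recurrence (G (suc i) (suc j)) (λ m → G i (suc (suc j)) m + G (suc (suc i)) j m)
    G-recurrence i j m = begin
      (1# + Q) * (E (suc i) (suc j) m + E (suc j) (suc i) m)
        ≈⟨ trans (distribˡ _ _ _) (+-cong (E-recurrence i j m) (E-recurrence j i m)) ⟩
      (q * (y * (E i (suc (suc j)) m + E (suc (suc i)) j m)) + y * ((1# - Q) * E (suc i) (suc j) (suc m)))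
        + (q * (y * (E j (suc (suc i)) m + E (suc (suc j)) i m)) + y * ((1# - Q) * E (suc j) (suc i) (suc m)))
        ≈⟨ solve 9 (λ q y Q a b c d e f →
             (q :* (y :* (a :+ b)) :+ y :* ((:1 :- Q) :* c)) :+ (q :* (y :* (d :+ e)) :+ y :* ((:1 :- Q) :* f)) :=
             q :* (y :* ((a :+ e) :+ (b :+ d))) :+ y :* ((:1 :- Q) :* (c :+ f))) refl _ _ _ _ _ _ _ _ _ ⟩
      q * (y * (G i (suc (suc j)) m + G (suc (suc i)) j m)) + y * ((1# - Q) * G (suc i) (suc j) (suc m)) ∎
      where
      y Q : Carrier
      y = pw m
      Q = (q * y) * (q * y)

    E-boundary : ∀ j m → E 0 (suc j) m + E (suc j) 0 m ≈ 0#
    E-boundary j m = begin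
      (0# - pw m * w 0 j m) + (pw m * power j m + U (power j) m - U (power j) m)
        ≈⟨ +-congʳ (+-congˡ (-‿cong (*-congˡ (w-zero j m)))) ⟩
      (0# - pw m * power j m) + (pw m * power j m + U (power j) m - U (power j) m)
        ≈⟨ +-congʳ (+-identityˡ _) ⟩
      - (pw m * power j m) + (pw m * power j m + U (power j) m - U (power j) m)
        ≈⟨ solve 2 (λ a b → :- a :+ (a :+ b :- b) := a :- a) refl _ _ ⟩
      pw m * power j m - pw m * power j m
        ≈⟨ -‿inverseʳ _ ⟩
      0# ∎

    -- Induction on s for all i and j at once: the recurrence gains a power of q in the interior,
    -- and the boundary values vanish by antisymmetry. `E` alone has nonzero boundary values in
    -- general, hence the symmetrisation.
    G-∣ : ∀ s i j m → q^ s ∣ G i j m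
    G-∣ zero    i       j       m = G i j m , sym (trans (*-congʳ pw-0) (*-identityˡ _))
    G-∣ (suc s) zero    zero    m = ∣-0 (suc s) (+-identityˡ 0#)
    G-∣ (suc s) zero    (suc j) m = ∣-0 (suc s) (E-boundary j m)
    G-∣ (suc s) (suc i) zero    m = ∣-0 (suc s) (trans (+-comm _ _) (E-boundary i m))
    G-∣ (suc s) (suc i) (suc j) m = recurrence-∣ (G-recurrence i j) s (G-∣ s (suc i) (suc j))
      (λ k → ∣-+ (G-∣ s i (suc (suc j)) k) (G-∣ s (suc (suc i)) j k)) m

    -- G (a + 1) (a + 1) = 2 E (a + 1) (a + 1), and 2 need not be cancellable.
    E-diagonal-∣ : ∀ s a m → q^ s ∣ E (suc a) (suc a) m
    E-diagonal-∣ zero    a m = E (suc a) (suc a) m , sym (trans (*-congʳ pw-0) (*-identityˡ _))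
    E-diagonal-∣ (suc s) a = recurrence-∣ (E-recurrence a a) s (E-diagonal-∣ s a)
      -- On the diagonal the source term is E a (a + 2) + E (a + 2) a, already symmetrised.
      (G-∣ s a (suc (suc a)))

    w-diagonal : ∀ a → w a (suc a) ≋ X (w (suc a) a)
    w-diagonal a m = x-y≈0⇒x≈y (∣-nilpotent (E-diagonal-∣ N a m))
      where
      x-y≈0⇒x≈y : ∀ {x y} → x - y ≈ 0# → x ≈ y
      x-y≈0⇒x≈y {x} {y} h = begin
        x            ≈⟨ solve 2 (λ x y → x := (x :- y) :+ y) refl x y ⟩
        x - y + y    ≈⟨ +-congʳ h ⟩
        0# + y       ≈⟨ +-identityˡ y ⟩
        y            ∎

    alternating : ℕ → Row
    alternating zero    = T invPoch
    alternating (suc a) = T (T⁻ (alternating a))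

    alternating-w : ∀ a → alternating a ≋ X (w (suc a) a)
    alternating-w zero m = trans (sym (w-zero 1 m)) (w-diagonal 0 m)
    alternating-w (suc a) m = trans
      (T-cong (λ n → trans (T⁻-cong (alternating-w a) n) (T⁻-X (w (suc a) a) n)) m)
      (w-diagonal (suc a) m)

    module _ (b : ℕ) where

      lhsKernel-τ : ∀ {i} → i ≢ b → ∀ x y → lhsKernel (suc b) (suc i) x y ≈ τ x y
      lhsKernel-τ {i} i≢b x y with i ≡ᵇ b | ℕₚ.≡ᵇ⇒≡ i b
      ... | false | _ = reflexive (≡.cong (λ n → triangle x * bin n y) (ℕₚ.+-identityʳ x))
      ... | true  | h = ⊥-elim (i≢b (h tt))

      lhsKernel-τ⁺ : ∀ x y → lhsKernel (suc b) (suc b) x y ≈ τ⁺ x y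
      lhsKernel-τ⁺ x y with b ≡ᵇ b | ℕₚ.≡⇒≡ᵇ b b ≡.refl
      ... | true | _ = reflexive (≡.cong (λ n → triangle x * bin n y) (ℕₚ.+-comm x 1))

      row-power : ∀ i → i ≤ b → row M i invPoch (lhsKernel (suc b)) ≋ power i
      row-power zero    _   m = refl
      row-power (suc i) i<b = act-cong M (row-power i (ℕₚ.<⇒≤ i<b)) (lhsKernel-τ (ℕₚ.<⇒≢ i<b))

      -- By `Y-T`, the one exceptional binomial, at position b + 1, inserts Y right after that
      -- factor T.
      row-w : ∀ j → row M (suc (j ℕ.+ b)) invPoch (lhsKernel (suc b)) ≋ w (suc b) j
      row-w zero    m = trans (act-cong M (row-power b ℕₚ.≤-refl) lhsKernel-τ⁺ m) (sym (Y-T (power b) m))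
      row-w (suc j) = act-cong M (row-w j) (lhsKernel-τ (λ e → ℕₚ.<⇒≢ (s≤s (ℕₚ.m≤n+m b j)) (≡.sym e)))

    row-alternating : ∀ j → row M (suc (j ℕ.+ j)) invPoch rhsKernel ≋ alternating j
    row-alternating zero    m = refl
    row-alternating (suc j) rewrite ℕₚ.+-suc j j =
      act-cong M
        (act-cong M (row-alternating j) (λ x y → *-congʳ (reflexive (alternatingWeight-odd j x))))
        (λ x y → *-congʳ (reflexive (alternatingWeight-even j x)))

    -- The two end weights differ by qˣ, which is exactly the X in `alternating-w`.
    totals-agree : ∀ b (F : Row) →
      total M (suc (b ℕ.+ b)) invPoch (lhsKernel (suc b)) (λ x → triangle x * F x) ≈
      total M (suc (b ℕ.+ b)) invPoch rhsKernel (λ x → triangle⁻ x * F x)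
    totals-agree b F = sum-congˡ (suc M) (λ x → begin
      row M (suc (b ℕ.+ b)) invPoch (lhsKernel (suc b)) x * (triangle x * F x)
        ≈⟨ *-congʳ (row-w b b x) ⟩
      w (suc b) b x * (triangle⁻ x * pw x * F x)
        ≈⟨ solve 4 (λ w t y f → w :* (t :* y :* f) := y :* w :* (t :* f)) refl _ _ _ _ ⟩
      X (w (suc b) b) x * (triangle⁻ x * F x)
        ≈⟨ *-congʳ (trans (row-alternating b x) (alternating-w b x)) ⟨
      row M (suc (b ℕ.+ b)) invPoch rhsKernel x * (triangle⁻ x * F x) ∎)

  -- Box sums of the two summands.

  pw-sumℕ : ∀ n f (g : Row) → (∀ i → pw (f i) ≈ g i) → pw (sumℕ n f) ≈ product n (λ i → g (i ∸ 1))
  pw-sumℕ zero    f g h = pw-0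
  pw-sumℕ (suc n) f g h = trans (pw-+ (sumℕ n f) (f n)) (*-cong (pw-sumℕ n f g h) (h n))

  pw-triangle⁻ : ∀ n → pw (n C 2) ≈ triangle⁻ n
  pw-triangle⁻ zero    = pw-0
  pw-triangle⁻ (suc n) = trans (reflexive (≡.cong pw ([1+n]C2 n)))
    (trans (pw-+ (n C 2) n) (*-congʳ (pw-triangle⁻ n)))

  pw-alternating : ∀ i x → pw (alternatingExponent i x) ≈ alternatingWeight i x
  pw-alternating zero          x = pw-triangle⁻ (suc x)
  pw-alternating (suc zero)    x = pw-triangle⁻ x
  pw-alternating (suc (suc i)) x = pw-alternating i x

  module Terms (F : Row) (b : ℕ) where

    -- The form to which 2 (b + 1) - 1 computes, so that tuples of length `suc n` are by definition
    -- tuples of length `2 * suc b`.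
    n : ℕ
    n = b ℕ.+ suc (b ℕ.+ 0)

    n≡ : n ≡ suc (b ℕ.+ b)
    n≡ = ≡.trans (ℕₚ.+-suc b (b ℕ.+ 0)) (≡.cong (λ m → suc (b ℕ.+ m)) (ℕₚ.+-identityʳ b))

    lhs rhs : (Fin (suc n) → ℕ) → Carrier
    lhs v = pw (sumℕ (suc n) (λ i → suc (at v i) C 2)) * (F (at v n) * (invPoch (at v 0) *
      product n (λ i → bin (at v (i ∸ 1) ℕ.+ (if i ≡ᵇ suc b then 1 else 0)) (at v i))))
    rhs v = pw (sumℕ (suc n) (λ i → alternatingExponent i (at v i))) * (F (at v n) * (invPoch (at v 0) *
      product n (λ i → bin (at v (i ∸ 1)) (at v i))))

    lhsEnd : Row
    lhsEnd x = triangle x * F x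

    lhs-total : ∀ M → box (suc n) M lhs ≈ total M n invPoch (lhsKernel (suc b)) lhsEnd
    lhs-total M = trans
      (box-cong (suc n) M (λ v → trans
        (*-congʳ (pw-sumℕ (suc n) _ (λ i → triangle (at v i)) (λ i → pw-triangle⁻ (suc (at v i)))))
        (weighted-chain n invPoch (λ _ → triangle) (λ i x y → bin (x ℕ.+ (if i ≡ᵇ suc b then 1 else 0)) y) F v)))
      (box-chain M n invPoch (lhsKernel (suc b)) lhsEnd)

    rhs-total : ∀ M → box (suc n) M rhs ≈ total M n invPoch rhsKernel (λ x → alternatingWeight n x * F x)
    rhs-total M = trans
      (box-cong (suc n) M (λ v → trans
        (*-congʳ (pw-sumℕ (suc n) _ (λ i → alternatingWeight i (at v i)) (λ i → pw-alternating i (at v i))))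
        (weighted-chain n invPoch alternatingWeight (λ _ → bin) F v)))
      (box-chain M n invPoch rhsKernel (λ x → alternatingWeight n x * F x))

    lhs-stable : ∀ {M} → N ≤ M → box (suc n) M lhs ≈ box (suc n) N lhs
    lhs-stable {M} N≤M = begin
      box (suc n) M lhs
        ≈⟨ lhs-total M ⟩
      total M n invPoch (lhsKernel (suc b)) lhsEnd
        ≡⟨ ≡.cong (λ M → total M n invPoch (lhsKernel (suc b)) lhsEnd) (ℕₚ.m∸n+n≡m N≤M) ⟨
      total (M ∸ N ℕ.+ N) n invPoch (lhsKernel (suc b)) lhsEnd
        ≈⟨ total-stable N (M ∸ N) n invPoch (lhsKernel (suc b)) lhsEnd
             (λ i x y N≤x → trans (*-congʳ (triangle-vanishes N≤x)) (zeroˡ _))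
             (λ x N≤x → trans (*-congʳ (triangle-vanishes N≤x)) (zeroˡ _)) ⟩
      total N n invPoch (lhsKernel (suc b)) lhsEnd
        ≈⟨ lhs-total N ⟨
      box (suc n) N lhs ∎

    rhs≈lhs : ∀ {M} → N ≤ M → box (suc n) M rhs ≈ box (suc n) M lhs
    rhs≈lhs {M} N≤M = begin
      box (suc n) M rhs
        ≈⟨ rhs-total M ⟩
      total M n invPoch rhsKernel (λ x → alternatingWeight n x * F x)
        ≡⟨ ≡.cong (λ n → total M n invPoch rhsKernel (λ x → alternatingWeight n x * F x)) n≡ ⟩
      total M (suc (b ℕ.+ b)) invPoch rhsKernel (λ x → alternatingWeight (suc (b ℕ.+ b)) x * F x)
        ≈⟨ sum-congˡ (suc M) (λ x → *-congˡ (*-congʳ (reflexive (alternatingWeight-odd b x)))) ⟩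
      total M (suc (b ℕ.+ b)) invPoch rhsKernel (λ x → triangle⁻ x * F x)
        ≈⟨ Truncated.totals-agree M N≤M b F ⟨
      total M (suc (b ℕ.+ b)) invPoch (lhsKernel (suc b)) lhsEnd
        ≡⟨ ≡.cong (λ n → total M n invPoch (lhsKernel (suc b)) lhsEnd) n≡ ⟨
      total M n invPoch (lhsKernel (suc b)) lhsEnd
        ≈⟨ lhs-total M ⟨
      box (suc n) M lhs ∎

-- Power series modulo a power of q.

module PowerSeries {c ℓ : Level} (R : CommutativeRing c ℓ) where
  open CommutativeRing R
  open Series R
  open Sums R
  open import Algebra.Properties.Ring ring using (-‿distribˡ-*; -0#≈0#)
  open import Relation.Binary.Reasoning.Setoid setoid

  negS : PS → PS
  negS f k = - f k

  tail : PS → PS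
  tail f k = f (suc k)

  mulS-0 : ∀ f g → mulS f g 0 ≈ f 0 * g 0
  mulS-0 f g = +-identityˡ _

  mulS-suc : ∀ f g k → mulS f g (suc k) ≈ f 0 * g (suc k) + mulS (tail f) g k
  mulS-suc f g k = sum-head (suc k) _

  mulS-sucʳ : ∀ f g k → mulS f g (suc k) ≈ mulS f (tail g) k + f (suc k) * g 0
  mulS-sucʳ f g k = +-cong
    (sum-cong (suc k) (λ i i≤k → *-congˡ (reflexive (≡.cong g (ℕₚ.+-∸-assoc 1 (ℕₚ.≤-pred i≤k))))))
    (*-congˡ (reflexive (≡.cong g (ℕₚ.n∸n≡0 (suc k)))))

  -- Only coefficients up to k enter, which is why multiplication respects equality modulo a power
  -- of q.
  mulS-cong : ∀ {f f′ g g′} k → (∀ i → i ≤ k → f i ≈ f′ i) → (∀ i → i ≤ k → g i ≈ g′ i) →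
    mulS f g k ≈ mulS f′ g′ k
  mulS-cong k hf hg = sum-cong (suc k) (λ i i≤k → *-cong (hf i (ℕₚ.≤-pred i≤k)) (hg (k ∸ i) (ℕₚ.m∸n≤m k i)))

  -- Splitting off the first term of one convolution matches splitting off the last term of the
  -- reversed one.
  mulS-comm : ∀ f g k → mulS f g k ≈ mulS g f k
  mulS-comm f g zero = +-congˡ (*-comm _ _)
  mulS-comm f g (suc k) = begin
    mulS f g (suc k)                          ≈⟨ mulS-suc f g k ⟩
    f 0 * g (suc k) + mulS (tail f) g k       ≈⟨ +-cong (*-comm _ _) (mulS-comm (tail f) g k) ⟩
    g (suc k) * f 0 + mulS g (tail f) k       ≈⟨ +-comm _ _ ⟩
    mulS g (tail f) k + g (suc k) * f 0       ≈⟨ mulS-sucʳ g f k ⟨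
    mulS g f (suc k)                          ∎

  mulS-distribʳ : ∀ h f g k → mulS (addS f g) h k ≈ mulS f h k + mulS g h k
  mulS-distribʳ h f g k = trans (sum-congˡ (suc k) (λ i → distribʳ _ _ _)) (sum-+ (suc k) _ _)

  mulS-distribˡ : ∀ h f g k → mulS h (addS f g) k ≈ mulS h f k + mulS h g k
  mulS-distribˡ h f g k = trans (sum-congˡ (suc k) (λ i → distribˡ _ _ _)) (sum-+ (suc k) _ _)

  mulS-scaleˡ : ∀ x f g k → mulS (λ i → x * f i) g k ≈ x * mulS f g k
  mulS-scaleˡ x f g k = trans (sum-congˡ (suc k) (λ i → *-assoc _ _ _)) (sym (sum-*ˡ (suc k) x _))

  mulS-assoc : ∀ f g h k → mulS (mulS f g) h k ≈ mulS f (mulS g h) k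
  mulS-assoc f g h zero = begin
    mulS (mulS f g) h 0      ≈⟨ mulS-0 (mulS f g) h ⟩
    mulS f g 0 * h 0         ≈⟨ *-congʳ (mulS-0 f g) ⟩
    f 0 * g 0 * h 0          ≈⟨ *-assoc _ _ _ ⟩
    f 0 * (g 0 * h 0)        ≈⟨ *-congˡ (mulS-0 g h) ⟨
    f 0 * mulS g h 0         ≈⟨ mulS-0 f (mulS g h) ⟨
    mulS f (mulS g h) 0      ∎
  mulS-assoc f g h (suc k) = begin
    mulS (mulS f g) h (suc k)
      ≈⟨ mulS-suc (mulS f g) h k ⟩
    mulS f g 0 * h (suc k) + mulS (tail (mulS f g)) h k
      ≈⟨ +-cong (*-congʳ (mulS-0 f g)) (mulS-cong {g = h} {g′ = h} k (λ i _ → mulS-suc f g i) (λ _ _ → refl)) ⟩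
    f 0 * g 0 * h (suc k) + mulS (addS (λ i → f 0 * tail g i) (mulS (tail f) g)) h k
      ≈⟨ +-cong (*-assoc _ _ _) (mulS-distribʳ h _ _ k) ⟩
    f 0 * (g 0 * h (suc k)) + (mulS (λ i → f 0 * tail g i) h k + mulS (mulS (tail f) g) h k)
      ≈⟨ +-congˡ (+-cong (mulS-scaleˡ (f 0) (tail g) h k) (mulS-assoc (tail f) g h k)) ⟩
    f 0 * (g 0 * h (suc k)) + (f 0 * mulS (tail g) h k + mulS (tail f) (mulS g h) k)
      ≈⟨ +-assoc _ _ _ ⟨
    f 0 * (g 0 * h (suc k)) + f 0 * mulS (tail g) h k + mulS (tail f) (mulS g h) k
      ≈⟨ +-congʳ (distribˡ _ _ _) ⟨
    f 0 * (g 0 * h (suc k) + mulS (tail g) h k) + mulS (tail f) (mulS g h) k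
      ≈⟨ +-congʳ (*-congˡ (mulS-suc g h k)) ⟨
    f 0 * mulS g h (suc k) + mulS (tail f) (mulS g h) k
      ≈⟨ mulS-suc f (mulS g h) k ⟨
    mulS f (mulS g h) (suc k) ∎

  mulS-zeroˡ : ∀ f k → mulS zeroS f k ≈ 0#
  mulS-zeroˡ f k = sum-0 (suc k) (λ i → zeroˡ _)

  mulS-oneˡ : ∀ f k → mulS oneS f k ≈ f k
  mulS-oneˡ f zero    = trans (mulS-0 oneS f) (*-identityˡ _)
  mulS-oneˡ f (suc k) = trans (mulS-suc oneS f k)
    (trans (+-cong (*-identityˡ _) (mulS-zeroˡ f k)) (+-identityʳ _))

  -- The quotient of R[[q]] by q^K: series stay whole and only equality is coarsened, so the
  -- operations of `Series` serve unchanged.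
  truncated : ℕ → CommutativeRing c ℓ
  truncated K = record
    { Carrier = PS
    ; _≈_     = λ f g → ∀ k → k < K → f k ≈ g k
    ; _+_     = addS
    ; _*_     = mulS
    ; -_      = negS
    ; 0#      = zeroS
    ; 1#      = oneS
    ; isCommutativeRing = record
      { isRing = record
        { +-isAbelianGroup = record
          { isGroup = record
            { isMonoid = record
              { isSemigroup = record
                { isMagma = record
                  { isEquivalence = record
                    { refl  = λ _ _ → refl
                    ; sym   = λ h k k<K → sym (h k k<K)
                    ; trans = λ h h′ k k<K → trans (h k k<K) (h′ k k<K)
                    }
                  ; ∙-cong = λ h h′ k k<K → +-cong (h k k<K) (h′ k k<K)
                  }
                ; assoc = λ _ _ _ _ _ → +-assoc _ _ _
                }
              ; identity = (λ _ _ _ → +-identityˡ _) , (λ _ _ _ → +-identityʳ _)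
              }
            ; inverse = (λ _ _ _ → -‿inverseˡ _) , (λ _ _ _ → -‿inverseʳ _)
            ; ⁻¹-cong = λ h k k<K → -‿cong (h k k<K)
            }
          ; comm = λ _ _ _ _ → +-comm _ _
          }
        ; *-cong = λ h h′ k k<K → mulS-cong k
            (λ i i≤k → h i (ℕₚ.≤-<-trans i≤k k<K)) (λ i i≤k → h′ i (ℕₚ.≤-<-trans i≤k k<K))
        ; *-assoc = λ f g h k _ → mulS-assoc f g h k
        ; *-identity = (λ f k _ → mulS-oneˡ f k) , (λ f k _ → trans (mulS-comm f oneS k) (mulS-oneˡ f k))
        ; distrib = (λ h f g k _ → mulS-distribˡ h f g k) , (λ h f g k _ → mulS-distribʳ h f g k)
        }
      ; *-comm = λ f g k _ → mulS-comm f g k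
      }
    }

  qpow-mulS-< : ∀ {k m} f → k < m → mulS (qpow m) f k ≈ 0#
  qpow-mulS-< {zero}  {suc m} f _ = trans (mulS-0 (qpow (suc m)) f) (zeroˡ _)
  qpow-mulS-< {suc k} {suc m} f k<m = trans (mulS-suc (qpow (suc m)) f k)
    (trans (+-cong (zeroˡ _) (qpow-mulS-< f (ℕₚ.≤-pred k<m))) (+-identityˡ _))

  qpow-mulS-+ : ∀ m f k → mulS (qpow m) f (m ℕ.+ k) ≈ f k
  qpow-mulS-+ zero    f k = mulS-oneˡ f k
  qpow-mulS-+ (suc m) f k = trans (mulS-suc (qpow (suc m)) f (m ℕ.+ k))
    (trans (+-cong (zeroˡ _) (qpow-mulS-+ m f k)) (+-identityˡ _))

  qpow-suc : ∀ n k → qpow (suc n) k ≈ mulS (qpow 1) (qpow n) k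
  qpow-suc n zero    = sym (qpow-mulS-< {0} {1} (qpow n) (s≤s z≤n))
  qpow-suc n (suc k) = sym (qpow-mulS-+ 1 (qpow n) k)

  qpow-< : ∀ {k m} → k < m → qpow m k ≈ 0#
  qpow-< {zero}  {suc m} _   = refl
  qpow-< {suc k} {suc m} k<m = qpow-< {k} {m} (ℕₚ.≤-pred k<m)

  -- The coefficients of `geo m` have period m + 1, so from degree m + 1 on they cancel against
  -- their shift; below that only the constant term is nonzero.
  geo-inverse : ∀ m k → mulS (addS oneS (negS (qpow (suc m)))) (geo m) k ≈ oneS k
  geo-inverse m k = begin
    mulS (addS oneS (negS (qpow (suc m)))) (geo m) k
      ≈⟨ mulS-distribʳ (geo m) oneS (negS (qpow (suc m))) k ⟩
    mulS oneS (geo m) k + mulS (negS (qpow (suc m))) (geo m) k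
      ≈⟨ +-cong (mulS-oneˡ (geo m) k) (mulS-negˡ (qpow (suc m)) (geo m) k) ⟩
    geo m k - mulS (qpow (suc m)) (geo m) k
      ≈⟨ geometric ⟩
    oneS k ∎
    where
    mulS-negˡ : ∀ f g k → mulS (negS f) g k ≈ - mulS f g k
    mulS-negˡ f g k = begin
      mulS (negS f) g k                    ≈⟨ mulS-cong {g = g} {g′ = g} k (λ i _ → trans (-‿cong (sym (*-identityˡ _))) (-‿distribˡ-* 1# (f i))) (λ _ _ → refl) ⟩
      mulS (λ i → - 1# * f i) g k          ≈⟨ mulS-scaleˡ (- 1#) f g k ⟩
      - 1# * mulS f g k                    ≈⟨ -‿distribˡ-* 1# _ ⟨
      - (1# * mulS f g k)                  ≈⟨ -‿cong (*-identityˡ _) ⟩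
      - mulS f g k                         ∎

    indicator : ℕ → Carrier
    indicator n = if n ≡ᵇ 0 then 1# else 0#

    geometric : geo m k - mulS (qpow (suc m)) (geo m) k ≈ oneS k
    geometric with ℕₚ.≤-<-connex (suc m) k
    ... | inj₂ k<m = begin
      geo m k - mulS (qpow (suc m)) (geo m) k   ≈⟨ +-cong (reflexive (≡.cong indicator (m<n⇒m%n≡m k<m))) (-‿cong (qpow-mulS-< (geo m) k<m)) ⟩
      oneS k - 0#                               ≈⟨ trans (+-congˡ -0#≈0#) (+-identityʳ _) ⟩
      oneS k                                    ∎
    ... | inj₁ m<k with k ∸ suc m | ℕₚ.m+[n∸m]≡n m<k
    ... | d | ≡.refl = begin
      geo m (suc m ℕ.+ d) - mulS (qpow (suc m)) (geo m) (suc m ℕ.+ d)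
        ≈⟨ +-cong (reflexive (≡.cong indicator (≡.trans (≡.cong (_% suc m) (ℕₚ.+-comm (suc m) d)) ([m+n]%n≡m%n d (suc m)))))
                  (-‿cong (qpow-mulS-+ (suc m) (geo m) d)) ⟩
      geo m d - geo m d
        ≈⟨ -‿inverseʳ _ ⟩
      0# ∎

-- The exponent sums of the two summands in closed form.

module Exponents {c ℓ : Level} (R : CommutativeRing c ℓ) where
  open Series R using (binSum; evenSum)

  -- The partial sums inside binSum and evenSum are local to their definitions. In the next two
  -- proofs the bound of the sum is generalised separately from the parameters of the local function,
  -- so that unification finds that function as the `s` of sumℕ-unique.
  module _ (a : ℕ) (N : Fin (2 ℕ.* a) → ℕ) (f : ℕ → ℕ) where
    binSum-sumℕ : (∀ i → suc (at N i) C 2 ≡ f i) → binSum a N ≡ sumℕ (2 ℕ.* a) f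
    binSum-sumℕ h with sumℕ-unique {f} ≡.refl (λ i → ≡.cong (_ ℕ.+_) (h i)) | 2 ℕ.* a
    ... | s | n = s n

  evenSum-unfold : (Tuple : ℕ → Set) (entries : ∀ {a} → Tuple a → Fin (2 ℕ.* a) → ℕ) (f : ∀ {a} → Tuple a → ℕ → ℕ) →
    (∀ {a} (N : Tuple a) i → at (entries N) (suc (2 ℕ.* i)) ≡ f N i) →
    ∀ b (N : Tuple (suc (b ℕ.+ 0))) →
    evenSum (suc (b ℕ.+ 0)) (entries N) ≡ sumℕ (b ℕ.+ 0) (f N) ℕ.+ at (entries N) (suc (2 ℕ.* (b ℕ.+ 0)))
  evenSum-unfold Tuple entries f h b N with at (entries N) (suc (2 ℕ.* (b ℕ.+ 0)))
  -- Writing `b + 0` for `b` lets the parameter `suc (b + 0)` and the bound `b + 0` be abstracted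
  -- one after the other; the opaque `Tuple` keeps the parameter visible in the type of `N`.
  ... | y with suc (b ℕ.+ 0) | N
  ...   | a | N′ with sumℕ-unique {f N′} ≡.refl (λ i → ≡.cong (_ ℕ.+_) (h N′ i)) | b ℕ.+ 0
  ...     | s | n = ≡.cong (ℕ._+ y) (s n)

  evenSum-sumℕ : ∀ b (N : Fin (2 ℕ.* suc b) → ℕ) → evenSum (suc b) N ≡ sumℕ (suc b) (λ i → at N (suc (2 ℕ.* i)))
  evenSum-sumℕ b = ≡.subst (λ b → (N : Fin (2 ℕ.* suc b) → ℕ) → evenSum (suc b) N ≡ sumℕ (suc b) (λ i → at N (suc (2 ℕ.* i))))
    (ℕₚ.+-identityʳ b)
    (evenSum-unfold (λ a → Fin (2 ℕ.* a) → ℕ) (λ N → N) (λ N i → at N (suc (2 ℕ.* i))) (λ _ _ → ≡.refl) b)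

  rhsExponent : ∀ b (N : Fin (2 ℕ.* suc b) → ℕ) →
    binSum (suc b) N ∸ evenSum (suc b) N ≡ sumℕ (2 ℕ.* suc b) (λ i → alternatingExponent i (at N i))
  rhsExponent b N = begin
    binSum (suc b) N ∸ evenSum (suc b) N
      ≡⟨ ≡.cong₂ _∸_ (≡.trans (binSum-sumℕ (suc b) N _ (λ _ → ≡.refl)) (≡.cong (λ n → sumℕ n (λ i → suc (at N i) C 2)) double))
                     (evenSum-sumℕ b N) ⟩
    sumℕ (suc b ℕ.+ suc b) (λ i → suc (at N i) C 2) ∸ even
      ≡⟨ ≡.cong (_∸ even) (sumℕ-alternating (at N) (suc b)) ⟩
    even ℕ.+ sumℕ (suc b ℕ.+ suc b) (λ i → alternatingExponent i (at N i)) ∸ even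
      ≡⟨ ℕₚ.m+n∸m≡n even _ ⟩
    sumℕ (suc b ℕ.+ suc b) (λ i → alternatingExponent i (at N i))
      ≡⟨ ≡.cong (λ n → sumℕ n (λ i → alternatingExponent i (at N i))) double ⟨
    sumℕ (2 ℕ.* suc b) (λ i → alternatingExponent i (at N i)) ∎
    where
    open ≡.≡-Reasoning
    double : 2 ℕ.* suc b ≡ suc b ℕ.+ suc b
    double = ≡.cong (suc b ℕ.+_) (ℕₚ.+-identityʳ (suc b))
    even : ℕ
    even = sumℕ (suc b) (λ i → at N (suc (2 ℕ.* i)))

-- Transfer to a single coefficient of the series.

module Coefficients {c ℓ : Level} (R : CommutativeRing c ℓ) (F : ℕ → Series.PS R) (b k : ℕ) where
  private
    module R = CommutativeRing R
    module S = Series R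
    A : CommutativeRing c ℓ
    -- The modulus q^(k+1) retains coefficient k and makes q nilpotent.
    A = PowerSeries.truncated R (suc k)
    open PowerSeries R using (qpow-suc; qpow-<; geo-inverse)
    open Exponents R
    open Chains A using (product; box)
    P : QPowers A
    P = record
      { pw          = S.qpow
      ; geo         = S.geo
      ; pw-0        = λ _ _ → R.refl
      ; pw-suc      = λ n j _ → qpow-suc n j
      ; geo-inverse = λ m j _ → geo-inverse m j
      }
    module B = QBinomials A P
    open Rows.Terms A P (suc k) (λ j j<K → qpow-< j<K) F b

  -- The operations of `A` are literally those of `Series R`, so the two versions agree
  -- propositionally and not just modulo a power of q.
  poch-≡ : ∀ n → S.poch n ≡ B.poch n
  poch-≡ zero    = ≡.refl
  poch-≡ (suc n) = ≡.cong (λ p → S.mulS p (λ j → S.oneS j R.- S.qpow (suc n) j)) (poch-≡ n)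

  invPoch-≡ : ∀ n → S.invPoch n ≡ B.invPoch n
  invPoch-≡ zero    = ≡.refl
  invPoch-≡ (suc n) = ≡.cong (λ p → S.mulS p (S.geo n)) (invPoch-≡ n)

  qbin-≡ : ∀ n m → S.qbin n m ≡ B.bin n m
  qbin-≡ n m rewrite poch-≡ n | invPoch-≡ m | invPoch-≡ (n ∸ m) = ≡.refl

  prodS-≡ : ∀ n {f g : ℕ → S.PS} → (∀ i → f i ≡ g i) → S.prodS n f ≡ product n g
  prodS-≡ zero    h = ≡.refl
  prodS-≡ (suc n) h = ≡.cong₂ S.mulS (prodS-≡ n h) (h (suc n))

  term-≡ : ∀ {e e′} f x {p p′ : S.PS} → e ≡ e′ → p ≡ p′ →
    S.mulS (S.qpow e) (S.mulS f (S.mulS (S.invPoch x) p)) ≡ S.mulS (S.qpow e′) (S.mulS f (S.mulS (B.invPoch x) p′))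
  term-≡ {e} f x {p} ≡.refl ≡.refl = ≡.cong (λ v → S.mulS (S.qpow e) (S.mulS f (S.mulS v p))) (invPoch-≡ x)

  lhsTerm-≡ : ∀ N → S.lhsTerm (suc b) F N ≡ lhs N
  lhsTerm-≡ N = term-≡ (F (at N n)) (at N 0) (binSum-sumℕ (suc b) N _ (λ _ → ≡.refl))
    (prodS-≡ n (λ i → qbin-≡ (at N (i ∸ 1) ℕ.+ (if i ≡ᵇ suc b then 1 else 0)) (at N i)))

  rhsTerm-≡ : ∀ N → S.rhsTerm (suc b) F N ≡ rhs N
  rhsTerm-≡ N = term-≡ (F (at N n)) (at N 0) (rhsExponent b N) (prodS-≡ n (λ i → qbin-≡ (at N (i ∸ 1)) (at N i)))

  sum-coefficient : ∀ n {f} {g : ℕ → R.Carrier} j → (∀ x → f x j ≡ g x) → Series.sumR A n f j ≡ S.sumR n g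
  sum-coefficient zero    j h = ≡.refl
  sum-coefficient (suc n) j h = ≡.cong₂ R._+_ (sum-coefficient n j h) (h n)

  box-coefficient : ∀ n M {t t′} j → (∀ N → t′ N ≡ t N) → box n M t j ≡ S.boxSum n M t′ j
  box-coefficient zero    M j h = ≡.cong (λ f → f j) (≡.sym (h _))
  box-coefficient (suc n) M j h = sum-coefficient (suc M) j (λ x → box-coefficient n M j (λ v → h (cons x v)))

  lhs-coefficient : ∀ {M} → suc k ≤ M →
    S.boxSum (2 ℕ.* suc b) M (S.lhsTerm (suc b) F) k R.≈ S.boxSum (2 ℕ.* suc b) (suc k) (S.lhsTerm (suc b) F) k
  lhs-coefficient {M} K≤M = ≡.subst₂ R._≈_
    (box-coefficient (2 ℕ.* suc b) M k lhsTerm-≡) (box-coefficient (2 ℕ.* suc b) (suc k) k lhsTerm-≡)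
    (lhs-stable K≤M k (ℕₚ.n<1+n k))

  -- The right-hand sum is compared with the left-hand one at the same bound M, and through it with
  -- the common value at bound k + 1.
  rhs-coefficient : ∀ {M} → suc k ≤ M →
    S.boxSum (2 ℕ.* suc b) M (S.rhsTerm (suc b) F) k R.≈ S.boxSum (2 ℕ.* suc b) (suc k) (S.lhsTerm (suc b) F) k
  rhs-coefficient {M} K≤M = R.trans
    (≡.subst₂ R._≈_
      (box-coefficient (2 ℕ.* suc b) M k rhsTerm-≡) (box-coefficient (2 ℕ.* suc b) M k lhsTerm-≡)
      (rhs≈lhs K≤M k (ℕₚ.n<1+n k)))
    (lhs-coefficient K≤M)

open import Data.Nat using (_*_)

theorem5p5 : {c ℓ : Level} (R : CommutativeRing c ℓ) (F : ℕ → Series.PS R) (a : ℕ) → 1 ≤ a →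
    Σ (Series.PS R) (λ s → Series.HasSum R (2 * a) (Series.lhsTerm R a F) s
    × Series.HasSum R (2 * a) (Series.rhsTerm R a F) s)
theorem5p5 R F (suc b) _ =
  -- Coefficient k of the common sum is read off at bound k + 1, from which point on it is constant.
  (λ k → Series.boxSum R (2 * suc b) (suc k) (Series.lhsTerm R (suc b) F) k) ,
  (λ k → suc k , λ M → Coefficients.lhs-coefficient R F b k) ,
  (λ k → suc k , λ M → Coefficients.rhs-coefficient R F b k)
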